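{- Let $R$ be an odd rectangle. Let $M$ be a minimum chain with span $R$ containing a pair of adjacent coins, say a chain between the coins $c$ and $c'$, and let $M'$ be a configuration. Then $M\xrightarrow{\mathcal{P}}M'$ if and only if $M'$ is a minimum chain between the same two coins $c$ and $c'$.
   Context: The board is the square grid: positions are the elements of $\mathbb{Z}^2$, each position having four neighbors (left, right, top, bottom); $\mathrm{dist}$ is the usual graph distance. A configuration is a finite subset $C\subset\mathbb{Z}^2$; its elements are called coins. The span of a configuration $C$ is the limit of the (eventually constant) sequence $C_0=C$, $C_{i+1}=C_i\cup\{p\notin C_i : p \text{ has at least two neighbors in } C_i\}$. An $m\times n$ rectangle is a set $I\times J$ with $I,J$ intervals of integers of cardinality $m$ and $n$; it is odd if $m+n$ is odd. A configuration is minimum if no configuration with the same span has fewer coins. If the span of a minimum configuration is an odd rectangle, the configuration contains at most one pair of adjacent coins. A chain between coins $c$ and $c'$ is a configuration $[c_1,\ldots,c_N]=\{c_1,\ldots,c_N\}$ formed by a sequence of distinct coins $c=c_1,c_2,\ldots,c_N=c'$ with $\mathrm{dist}(c_i,c_{i+1})\in\{1,2\}$ for all $i\in\{1,\ldots,N-1\}$. A minimum chain is a chain that is a minimum configuration. Pokes: let $M$ be a minimum configuration with span $R$ containing a pair $\{c_1,c_2\}$ of adjacent coins. A poke from $M$ consists, for some $i\in\{1,2\}$, in replacing $c_i$ by one of its free neighboring positions $p\notin M$ such that $p$ has at least one neighboring coin in $M$ other than $c_i$; the result is $(M\setminus\{c_i\})\cup\{p\}$, which is again a minimum configuration with span $R$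 containing a pair of adjacent coins. We write $M\xrightarrow{\mathcal{P}}M'$ if $M'$ is obtained from $M$ by a finite (possibly empty) sequence of pokes. -}

module Defs where

open import Data.Integer.Base as ℤ using (ℤ; +_)
open import Data.List.Base using (List; []; _∷_; length; head; last)
open import Data.List.Membership.Propositional using () renaming (_∈_ to _∈ˡ_)
open import Data.List.Relation.Unary.Linked using (Linked)
open import Data.List.Relation.Unary.Unique.Propositional using (Unique)
open import Data.Maybe.Base using (just)
open import Data.Nat.Base using (ℕ; zero; suc; _+_; _≤_; _<_; parity)
open import Data.Parity.Base using (1ℙ)
open import Data.Product.Base using (_×_; _,_; ∃-syntax)
open import Data.Sum.Base using (_⊎_)
open import Level using (0ℓ)
open import Relation.Binary.Construct.Closure.ReflexiveTransitive using (Star)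
open import Relation.Binary.PropositionalEquality.Core using (_≡_; _≢_)
open import Relation.Nullary.Negation.Core using (¬_)
open import Relation.Unary using (Pred; _∈_; _∉_; _∪_; _∖_; _≐_; ｛_｝)

Position : Set
Position = ℤ × ℤ

neighbours : Position → List Position
neighbours (x , y) =
  (ℤ.pred x , y) ∷ (ℤ.suc x , y) ∷ (x , ℤ.suc y) ∷ (x , ℤ.pred y) ∷ []

Adjacent : Position → Position → Set
Adjacent p q = q ∈ˡ neighbours p

data Walk : ℕ → Position → Position → Set where
  stop : ∀ {p} → Walk zero p p
  step : ∀ {n p q r} → Adjacent p q → Walk n q r → Walk (suc n) p r

-- dist p q = n, as a relation: n is the least length of a walk from p to q.
Dist : Position → Position → ℕ → Set
Dist p q n = Walk n p q × (∀ k → Walk k p q → n ≤ k)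

-- A finite subset of ℤ², given by a repetition-free enumeration.  The order
-- of the enumeration carries no meaning: configurations are compared through
-- their underlying predicates ⟦_⟧, never with _≡_.
record Configuration : Set where
  constructor configuration
  field
    coins  : List Position
    unique : Unique coins

open Configuration public

⟦_⟧ : Configuration → Pred Position 0ℓ
⟦ C ⟧ p = p ∈ˡ coins C

size : Configuration → ℕ
size C = length (coins C)

TwoNeighboursIn : Pred Position 0ℓ → Pred Position 0ℓ
TwoNeighboursIn P p =
  ∃[ q ] ∃[ r ] q ≢ r × Adjacent p q × Adjacent p r × q ∈ P × r ∈ P

grow : Configuration → ℕ → Pred Position 0ℓ
grow C zero    = ⟦ C ⟧
grow C (suc i) = grow C i ∪ (λ p → p ∉ grow C i × p ∈ TwoNeighboursIn (grow C i))

-- The sequence grow C is increasing, so its limit is its union.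
span : Configuration → Pred Position 0ℓ
span C p = ∃[ i ] p ∈ grow C i

record Interval : Set where
  constructor interval
  field
    start       : ℤ
    cardinality : ℕ

open Interval public

⟦_⟧ᴵ : Interval → Pred ℤ 0ℓ
⟦ I ⟧ᴵ x = start I ℤ.≤ x × x ℤ.< start I ℤ.+ + cardinality I

record Rectangle : Set where
  constructor _⊠_
  field
    horizontal : Interval
    vertical   : Interval

open Rectangle public

⟦_⟧ᴿ : Rectangle → Pred Position 0ℓ
⟦ R ⟧ᴿ (x , y) = x ∈ ⟦ horizontal R ⟧ᴵ × y ∈ ⟦ vertical R ⟧ᴵ

OddRectangle : Rectangle → Set
OddRectangle R =
  parity (cardinality (horizontal R) + cardinality (vertical R)) ≡ 1ℙ

HasSpan : Configuration → Rectangle → Set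
HasSpan C R = span C ≐ ⟦ R ⟧ᴿ

Minimum : Configuration → Set
Minimum C = ∀ (D : Configuration) → span D ≐ span C → ¬ (size D < size C)

HasAdjacentPair : Configuration → Set
HasAdjacentPair C = ∃[ p ] ∃[ q ] p ∈ ⟦ C ⟧ × q ∈ ⟦ C ⟧ × Adjacent p q

record Chain (c c′ : Position) (C : Configuration) : Set where
  field
    sequence : List Position
    distinct : Unique sequence
    first    : head sequence ≡ just c
    final    : last sequence ≡ just c′
    steps    : Linked (λ p q → Dist p q 1 ⊎ Dist p q 2) sequence
    covers   : ⟦ C ⟧ ≐ (_∈ˡ sequence)

MinimumChain : Position → Position → Configuration → Set
MinimumChain c c′ C = Chain c c′ C × Minimum C

-- The coin being replaced is either element of an adjacent pair; the other
-- one is its partner.  The result is determined as a set, in line with how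
-- configurations are compared.
record Poke (R : Rectangle) (M M′ : Configuration) : Set where
  field
    minimum    : Minimum M
    spans      : HasSpan M R
    coin       : Position
    partner    : Position
    coin∈M     : coin ∈ ⟦ M ⟧
    partner∈M  : partner ∈ ⟦ M ⟧
    pair       : Adjacent coin partner
    target     : Position
    reachable  : Adjacent coin target
    free       : target ∉ ⟦ M ⟧
    supported  : ∃[ q ] q ∈ ⟦ M ⟧ × q ≢ coin × Adjacent target q
    result     : ⟦ M′ ⟧ ≐ ((⟦ M ⟧ ∖ ｛ coin ｝) ∪ ｛ target ｝)

-- Star only provides the empty sequence from M to M itself, hence the final
-- comparison up to the order of enumeration.
_⟶𝒫[_]_ : Configuration → Rectangle → Configuration → Set
M ⟶𝒫[ R ] M′ = ∃[ N ] Star (Poke R) M N × ⟦ N ⟧ ≐ ⟦ M′ ⟧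

{-# OPTIONS --safe #-}

-- A chain whose steps have total length L has coins in a box of half perimeter
-- at most L + 2, with equality only if each coordinate is monotone along the chain,
-- and its span is the whole bounding box.  Comparing with a staircase of the same
-- box, a minimum chain that has a step of length one has exactly one, and is
-- monotone.  It is then a lattice word, read from c to c′ and cut into pairs of
-- letters and one single letter.  Pokes move the single letter by one pair, and the
-- order inside a pair is invisible, so all words with the same letters are joined
-- by pokes; monotone words with the same ends do have the same letters.

module Submission where

open import Defs
open import Algebra.Bundles using (AbelianGroup)
open import Algebra.Properties.Group using (∙-cancelʳ)
open import Data.Empty using (⊥-elim)
open import Data.Integer.Base as ℤ using (ℤ; +_; -[1+_]; 0ℤ; 1ℤ; -1ℤ; ∣_∣)
import Data.Integer.Properties as ℤ
open import Data.Integer.Tactic.RingSolver using (solve-∀)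
open import Data.List.Base using (List; []; _∷_; _++_; length; map; replicate; head; last)
open import Data.List.Membership.Propositional using (find; lose) renaming (_∈_ to _∈ˡ_; _∉_ to _∉ˡ_)
open import Data.List.Membership.Propositional.Properties using (∈-∃++; ∈-++⁺ˡ; ∈-++⁺ʳ; ∈-++⁻; ∈-map⁺; ∈-map⁻)
open import Data.List.Properties using (length-++)
open import Data.List.Relation.Unary.All as All using (All; []; _∷_)
open import Data.List.Relation.Unary.Any as Any using (here; there)
open import Data.List.Relation.Unary.AllPairs using ([]; _∷_)
open import Data.List.Relation.Unary.Linked using (Linked; []; [-]; _∷_)
open import Data.List.Relation.Unary.Unique.Propositional using (Unique)
open import Data.List.Relation.Binary.Permutation.Propositional
  using (_↭_; refl; prep; swap; ↭-refl; ↭-reflexive; ↭-sym; ↭-trans; ↭-prep; ↭-swap)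
open import Data.List.Relation.Binary.Permutation.Propositional.Properties
  using (↭-length; All-resp-↭; ++⁺ˡ) renaming (shift to ↭-shift)
open import Data.Maybe.Base using (just)
open import Data.Maybe.Properties using (just-injective)
open import Data.Nat.Base as ℕ using (ℕ; zero; suc; _+_; _∸_; _≤_; z≤n; s≤s; parity; _⊔_; ⌈_/2⌉)
import Data.Nat.Properties as ℕ
open import Data.Parity.Base using (Parity; 0ℙ; 1ℙ; _⁻¹) renaming (_+_ to _+ℙ_)
open import Data.Parity.Properties using (⁻¹-involutive; ⁻¹-injective)
open import Data.Product.Base using (∃; ∃₂; _×_; _,_; proj₁; proj₂)
open import Data.Product.Properties using (≡-dec)
open import Data.Sum.Base using (_⊎_; inj₁; inj₂; [_,_]′)
open import Function.Base using (_∘_; id)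
open import Function.Bundles using (_⇔_; mk⇔)
open import Level using (0ℓ)
open import Relation.Binary.Construct.Closure.ReflexiveTransitive using (Star; ε; _◅_; _◅◅_; gmap; reverse)
open import Relation.Binary.Definitions using (DecidableEquality)
open import Relation.Binary.PropositionalEquality
  using (_≡_; _≢_; refl; sym; trans; cong; cong₂; subst; module ≡-Reasoning)
open import Relation.Nullary using (¬_; yes; no; ¬?)
open import Relation.Nullary.Decidable using (map′; _×-dec_; _⊎-dec_)
open import Relation.Unary using (Pred; _∈_; _∉_; _⊆_; _≐_; _∪_; _∖_; ｛_｝; Decidable)
open import Relation.Unary.Properties using (≐-refl; ≐-sym; ≐-trans)

-- Minimality is only an inequality between numbers of coins; its force comes from one unit of
-- rounding. Let W be the sum of the width and height of the box, measured in moves. A staircase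
-- needs ⌈W/2⌉ steps, while twice the number of steps of a chain is its number of letters plus its
-- number of single steps. Rounding leaves a slack of one, a single step uses it up, and then no
-- letter can be wasted on going back along an axis. For the converse, `M′` comes with its two ends
-- only: neither its span nor an adjacent pair is given. Checkerboard colours bridge the gap,
-- because steps of length two keep the colour of a coin and a lone single step changes it. A poke
-- may choose its coin, target and supporter freely, so that it keeps the chain structure has to be
-- proved. The linear form s x + t y, with signs chosen to make it increase along the chain, does
-- this for all four quadrants at once: it bounds distances from below and thereby locates every
-- coin involved.

module _ {A : Set} where

  ∈-remove : ∀ {z x : A} as {bs} → z ≢ x → z ∈ˡ as ++ x ∷ bs → z ∈ˡ as ++ bs
  ∈-remove as z≢x z∈ with ∈-++⁻ as z∈
  ... | inj₁ z∈as         = ∈-++⁺ˡ z∈as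
  ... | inj₂ (here z≡x)   = ⊥-elim (z≢x z≡x)
  ... | inj₂ (there z∈bs) = ∈-++⁺ʳ as z∈bs

  length-insert : ∀ (x : A) as bs → length (as ++ x ∷ bs) ≡ suc (length (as ++ bs))
  length-insert x as bs
    rewrite length-++ as {x ∷ bs} | length-++ as {bs} = ℕ.+-suc (length as) (length bs)

  -- Pigeonhole principle. Configurations are compared as sets, and this turns inclusions into
  -- inequalities between sizes.
  unique⇒length≤ : ∀ {xs ys : List A} → Unique xs → (∀ {z} → z ∈ˡ xs → z ∈ˡ ys) →
                   length xs ≤ length ys
  unique⇒length≤ []             xs⊆ys = z≤n
  unique⇒length≤ {x ∷ xs} (x∉xs ∷ xs!) xs⊆ys with ∈-∃++ (xs⊆ys (here refl))
  ... | as , bs , refl rewrite length-insert x as bs = s≤s (unique⇒length≤ xs! λ z∈xs →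
    ∈-remove as (λ { refl → All.lookup x∉xs z∈xs refl }) (xs⊆ys (there z∈xs)))

  -- Replacement in place: a poke changes one coin of a chain and keeps the order of all others.
  data Replace (x y : A) : List A → List A → Set where
    here  : ∀ {zs} → Replace x y (x ∷ zs) (y ∷ zs)
    there : ∀ {z xs ys} → Replace x y xs ys → Replace x y (z ∷ xs) (z ∷ ys)

  module _ {x y : A} where

    Replace-sym : ∀ {xs ys} → Replace x y xs ys → Replace y x ys xs
    Replace-sym here      = here
    Replace-sym (there r) = there (Replace-sym r)

    old∈ : ∀ {xs ys} → Replace x y xs ys → x ∈ˡ xs
    old∈ here      = here refl
    old∈ (there r) = there (old∈ r)

    replaced : ∀ {xs ys z} → Replace x y xs ys → z ∈ˡ xs → z ≢ x → z ∈ˡ ys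
    replaced here      (here refl) z≢x = ⊥-elim (z≢x refl)
    replaced here      (there z∈)  z≢x = there z∈
    replaced (there r) (here refl) z≢x = here refl
    replaced (there r) (there z∈)  z≢x = there (replaced r z∈ z≢x)

  ∉-tail : ∀ {x : A} {xs} → Unique (x ∷ xs) → x ∉ˡ xs
  ∉-tail (x∉xs ∷ _) x∈xs = All.lookup x∉xs x∈xs refl

  new∉ : ∀ {x y : A} {xs ys} → Replace x y xs ys → Unique ys → x ≢ y → y ∉ˡ xs
  new∉ here      u       x≢y (here refl) = x≢y refl
  new∉ here      u       x≢y (there y∈)  = ∉-tail u y∈
  new∉ (there r) u       x≢y (here refl) = ∉-tail u (old∈ (Replace-sym r))
  new∉ (there r) (_ ∷ u) x≢y (there y∈)  = new∉ r u x≢y y∈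

  replace-≐ : ∀ {x y : A} {xs ys} → DecidableEquality A → Replace x y xs ys →
              Unique xs → Unique ys → x ≢ y →
              (_∈ˡ ys) ≐ (((_∈ˡ xs) ∖ ｛ x ｝) ∪ ｛ y ｝)
  replace-≐ {x} {y} {xs} {ys} _≟_ r xs! ys! x≢y = to , from
    where
    to : ∀ {z} → z ∈ˡ ys → z ∈ (((_∈ˡ xs) ∖ ｛ x ｝) ∪ ｛ y ｝)
    to {z} z∈ with z ≟ y
    ... | yes refl = inj₂ refl
    ... | no z≢y   = inj₁ (replaced (Replace-sym r) z∈ z≢y ,
                           λ { refl → new∉ (Replace-sym r) xs! (x≢y ∘ sym) z∈ })
    from : ∀ {z} → z ∈ (((_∈ˡ xs) ∖ ｛ x ｝) ∪ ｛ y ｝) → z ∈ˡ ys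
    from (inj₁ (z∈ , x≢z)) = replaced r z∈ (x≢z ∘ sym)
    from (inj₂ refl)       = old∈ (Replace-sym r)

-- Paths generated by a list of steps

module _ {A B : Set} (f : B → A → A) where

  path : A → List B → List A
  path a []       = a ∷ []
  path a (b ∷ bs) = a ∷ path (f b a) bs

  arrive : A → List B → A
  arrive a []       = a
  arrive a (b ∷ bs) = arrive (f b a) bs

  start∈path : ∀ a bs → a ∈ˡ path a bs
  start∈path a []       = here refl
  start∈path a (b ∷ bs) = here refl

  arrive∈path : ∀ a bs → arrive a bs ∈ˡ path a bs
  arrive∈path a []       = here refl
  arrive∈path a (b ∷ bs) = there (arrive∈path (f b a) bs)

  head-path : ∀ a bs → head (path a bs) ≡ just a
  head-path a []       = refl
  head-path a (b ∷ bs) = refl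

  last-path : ∀ a bs → last (path a bs) ≡ just (arrive a bs)
  last-path a []            = refl
  last-path a (b ∷ [])      = refl
  last-path a (b ∷ b′ ∷ bs) = last-path (f b a) (b′ ∷ bs)

  length-path : ∀ a bs → length (path a bs) ≡ suc (length bs)
  length-path a []       = refl
  length-path a (b ∷ bs) = cong suc (length-path (f b a) bs)

  -- `P` spreads along the path from its start, supported at every point by `Q`. A column or row is
  -- filled in this way beside one that is already full.
  path-induction : {P Q : A → Set} → (∀ b {a} → P a → Q (f b a) → P (f b a)) →
                   ∀ a bs → P a → (∀ {x} → x ∈ˡ path a bs → Q x) →
                   ∀ {x} → x ∈ˡ path a bs → P x
  path-induction ind a []       Pa Q (here refl) = Pa
  path-induction ind a (b ∷ bs) Pa Q (here refl) = Pa
  path-induction ind a (b ∷ bs) Pa Q (there x∈)  =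
    path-induction ind (f b a) bs (ind b Pa (Q (there (start∈path (f b a) bs)))) (Q ∘ there) x∈

module _ {A A′ B B′ : Set} {f : B → A → A} {f′ : B′ → A′ → A′} (g : A → A′) (h : B → B′)
         (comm : ∀ b a → g (f b a) ≡ f′ (h b) (g a)) where

  -- Applied to the coordinate projections, this makes the shadow of a planar walk on an axis a path
  -- of its own.
  map-path : ∀ a bs → map g (path f a bs) ≡ path f′ (g a) (map h bs)
  map-path a []       = refl
  map-path a (b ∷ bs) rewrite sym (comm b a) = cong (g a ∷_) (map-path (f b a) bs)

  map-arrive : ∀ a bs → g (arrive f a bs) ≡ arrive f′ (g a) (map h bs)
  map-arrive a []       = refl
  map-arrive a (b ∷ bs) rewrite sym (comm b a) = map-arrive (f b a) bs

-- Moves on the grid and the checkerboard colouring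

data Direction : Set where
  left right up down : Direction

move : Direction → Position → Position
move left  (x , y) = ℤ.pred x , y
move right (x , y) = ℤ.suc x , y
move up    (x , y) = x , ℤ.suc y
move down  (x , y) = x , ℤ.pred y

adjacent-move : ∀ d p → Adjacent p (move d p)
adjacent-move left  p = here refl
adjacent-move right p = there (here refl)
adjacent-move up    p = there (there (here refl))
adjacent-move down  p = there (there (there (here refl)))

adjacent⇒move : ∀ {p q} → Adjacent p q → ∃ λ d → q ≡ move d p
adjacent⇒move (here refl)                         = left , refl
adjacent⇒move (there (here refl))                 = right , refl
adjacent⇒move (there (there (here refl)))         = up , refl
adjacent⇒move (there (there (there (here refl)))) = down , refl

opposite : Direction → Direction
opposite left  = right
opposite right = left
opposite up    = down
opposite down  = up

move-opposite : ∀ d p → move (opposite d) (move d p) ≡ p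
move-opposite left  (x , y) = cong (_, y) (ℤ.suc-pred x)
move-opposite right (x , y) = cong (_, y) (ℤ.pred-suc x)
move-opposite up    (x , y) = cong (x ,_) (ℤ.pred-suc y)
move-opposite down  (x , y) = cong (x ,_) (ℤ.suc-pred y)

adjacent-sym : ∀ {p q} → Adjacent p q → Adjacent q p
adjacent-sym {p} adj with adjacent⇒move adj
... | d , refl = subst (Adjacent (move d p)) (move-opposite d p) (adjacent-move (opposite d) (move d p))

i≢pred[i] : ∀ {i} → i ≢ ℤ.pred i
i≢pred[i] {i} eq = ℤ.i≢suc[i] (sym (trans (cong ℤ.suc eq) (ℤ.suc-pred i)))

colourℤ : ℤ → Parity
colourℤ i = parity ∣ i ∣

parity-suc : ∀ n → parity (suc n) ≡ parity n ⁻¹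
parity-suc zero          = refl
parity-suc (suc zero)    = refl
parity-suc (suc (suc n)) = parity-suc n

colourℤ-suc : ∀ i → colourℤ (ℤ.suc i) ≡ colourℤ i ⁻¹
colourℤ-suc (+ n)        = parity-suc n
colourℤ-suc -[1+ zero ]  = refl
colourℤ-suc -[1+ suc n ] =
  sym (trans (cong _⁻¹ (parity-suc (suc n))) (⁻¹-involutive (parity (suc n))))

colourℤ-pred : ∀ i → colourℤ (ℤ.pred i) ≡ colourℤ i ⁻¹
colourℤ-pred i = begin
  colourℤ (ℤ.pred i)              ≡⟨ ⁻¹-involutive _ ⟨
  (colourℤ (ℤ.pred i) ⁻¹) ⁻¹      ≡⟨ cong _⁻¹ (colourℤ-suc (ℤ.pred i)) ⟨
  colourℤ (ℤ.suc (ℤ.pred i)) ⁻¹   ≡⟨ cong (λ j → colourℤ j ⁻¹) (ℤ.suc-pred i) ⟩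
  colourℤ i ⁻¹                    ∎
  where open ≡-Reasoning

colour : Position → Parity
colour (x , y) = colourℤ x +ℙ colourℤ y

⁻¹-+ : ∀ p q → p ⁻¹ +ℙ q ≡ (p +ℙ q) ⁻¹
⁻¹-+ 0ℙ q = refl
⁻¹-+ 1ℙ q = sym (⁻¹-involutive q)

+-⁻¹ : ∀ p q → p +ℙ q ⁻¹ ≡ (p +ℙ q) ⁻¹
+-⁻¹ 0ℙ q = refl
+-⁻¹ 1ℙ q = refl

colour-move : ∀ d p → colour (move d p) ≡ colour p ⁻¹
colour-move left  (x , y) rewrite colourℤ-pred x = ⁻¹-+ (colourℤ x) (colourℤ y)
colour-move right (x , y) rewrite colourℤ-suc x  = ⁻¹-+ (colourℤ x) (colourℤ y)
colour-move up    (x , y) rewrite colourℤ-suc y  = +-⁻¹ (colourℤ x) (colourℤ y)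
colour-move down  (x , y) rewrite colourℤ-pred y = +-⁻¹ (colourℤ x) (colourℤ y)

p≢p⁻¹ : ∀ {p} → p ≢ p ⁻¹
p≢p⁻¹ {0ℙ} ()
p≢p⁻¹ {1ℙ} ()

adjacent⇒colour : ∀ {p q} → Adjacent p q → colour q ≡ colour p ⁻¹
adjacent⇒colour {p} adj with adjacent⇒move adj
... | d , refl = colour-move d p

_≟ᴾ_ : DecidableEquality Position
_≟ᴾ_ = ≡-dec ℤ._≟_ ℤ._≟_

-- Closed sets, spans and the effect of a poke

Closed : (Position → Set) → Set
Closed P = ∀ {p} → p ∈ TwoNeighboursIn P → p ∈ P

between-closed : ∀ {P p q r} → Closed P → Adjacent p q → Adjacent p r → q ≢ r → q ∈ P → r ∈ P → p ∈ P
between-closed closed p~q p~r q≢r q∈P r∈P = closed (_ , _ , q≢r , p~q , p~r , q∈P , r∈P)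

twoNeighbours? : ∀ {P : (Position → Set)} → Decidable P → Decidable (TwoNeighboursIn P)
twoNeighbours? {P} P? p = map′ to from
  (Any.any? (λ q → Any.any? (λ r → ¬? (q ≟ᴾ r) ×-dec (P? q ×-dec P? r)) (neighbours p)) (neighbours p))
  where
  Pairs : Set
  Pairs = Any.Any (λ q → Any.Any (λ r → ¬ q ≡ r × P q × P r) (neighbours p)) (neighbours p)
  to : Pairs → p ∈ TwoNeighboursIn P
  to any with find any
  ... | q , p~q , any′ with find any′
  ... | r , p~r , q≢r , q∈P , r∈P = q , r , q≢r , p~q , p~r , q∈P , r∈P
  from : p ∈ TwoNeighboursIn P → Pairs
  from (q , r , q≢r , p~q , p~r , q∈P , r∈P) = lose p~q (lose p~r (q≢r , q∈P , r∈P))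

-- A position enters `grow` only with a proof that it was absent from the previous stage. Closedness
-- of the span therefore rests on deciding membership in a stage.
grow? : ∀ C i → Decidable (grow C i)
grow? C zero    p = Any.any? (p ≟ᴾ_) (coins C)
grow? C (suc i) p = grow? C i p ⊎-dec (¬? (grow? C i p) ×-dec twoNeighbours? (grow? C i) p)

grow-mono : ∀ C {i j} → i ≤ j → grow C i ⊆ grow C j
grow-mono C i≤j = go (ℕ.≤⇒≤′ i≤j)
  where
  go : ∀ {i j} → i ℕ.≤′ j → grow C i ⊆ grow C j
  go ℕ.≤′-refl        p∈ = p∈
  go (ℕ.≤′-step i≤′j) p∈ = inj₁ (go i≤′j p∈)

span-closed : ∀ C → Closed (span C)
span-closed C {p} (q , r , q≢r , p~q , p~r , (i , q∈) , (j , r∈)) with grow? C (i ⊔ j) p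
... | yes p∈ = i ⊔ j , p∈
... | no  p∉ = suc (i ⊔ j) , inj₂ (p∉ , q , r , q≢r , p~q , p~r ,
                 grow-mono C (ℕ.m≤m⊔n i j) q∈ , grow-mono C (ℕ.m≤n⊔m i j) r∈)

coins⊆span : ∀ C → ⟦ C ⟧ ⊆ span C
coins⊆span C p∈ = 0 , p∈

span-least : ∀ C {P} → Closed P → ⟦ C ⟧ ⊆ P → span C ⊆ P
span-least C {P} closed C⊆P (i , p∈) = go i p∈
  where
  go : ∀ i → grow C i ⊆ P
  go zero    p∈        = C⊆P p∈
  go (suc i) (inj₁ p∈) = go i p∈
  go (suc i) (inj₂ (_ , q , r , q≢r , p~q , p~r , q∈ , r∈)) =
    between-closed closed p~q p~r q≢r (go i q∈) (go i r∈)

span-≐ : ∀ C D → ⟦ C ⟧ ⊆ span D → ⟦ D ⟧ ⊆ span C → span C ≐ span D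
span-≐ C D C⊆D D⊆C = span-least C (span-closed D) C⊆D , span-least D (span-closed C) D⊆C

span-cong : ∀ C D → ⟦ C ⟧ ≐ ⟦ D ⟧ → span C ≐ span D
span-cong C D (C⊆D , D⊆C) = span-≐ C D (coins⊆span D ∘ C⊆D) (coins⊆span C ∘ D⊆C)

minimum-resp : ∀ C D → span C ≐ span D → size D ≤ size C → Minimum C → Minimum D
minimum-resp C D C≐D D≤C min E E≐D E<D = min E (≐-trans E≐D (≐-sym C≐D)) (ℕ.<-≤-trans E<D D≤C)

minimum-cong : ∀ C D → ⟦ C ⟧ ≐ ⟦ D ⟧ → Minimum C → Minimum D
minimum-cong C D C≐D = minimum-resp C D (span-cong C D C≐D) (unique⇒length≤ (unique D) (proj₂ C≐D))

-- Both the removed and the added coin have two neighbours in the other configuration.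
poke-span : ∀ {R M M′} → Poke R M M′ → span M ≐ span M′
poke-span {M = M} {M′} p = span-≐ M M′ M⊆ M′⊆
  where
  open Poke p
  partner∈M′ : partner ∈ ⟦ M′ ⟧
  partner∈M′ = proj₂ result (inj₁ (partner∈M , λ { refl → p≢p⁻¹ (adjacent⇒colour pair) }))
  M⊆ : ⟦ M ⟧ ⊆ span M′
  M⊆ {z} z∈ with z ≟ᴾ coin
  ... | no z≢coin = coins⊆span M′ (proj₂ result (inj₁ (z∈ , z≢coin ∘ sym)))
  ... | yes refl  = between-closed (span-closed M′) reachable pair (λ { refl → free partner∈M })
                      (coins⊆span M′ (proj₂ result (inj₂ refl))) (coins⊆span M′ partner∈M′)
  M′⊆ : ⟦ M′ ⟧ ⊆ span M
  M′⊆ z∈ with proj₁ result z∈ | supported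
  ... | inj₁ (z∈M , _) | _ = coins⊆span M z∈M
  ... | inj₂ refl      | q , q∈M , q≢coin , target~q =
    between-closed (span-closed M) (adjacent-sym reachable) target~q (q≢coin ∘ sym)
      (coins⊆span M coin∈M) (coins⊆span M q∈M)

-- Deleting the poked coin from the enumeration of `M` and prepending the target keeps the length,
-- and the resulting list contains `M′`.
poke-size : ∀ {R M M′} → Poke R M M′ → size M′ ≤ size M
poke-size {M = M} {M′} p with ∈-∃++ (Poke.coin∈M p)
... | as , bs , eq rewrite eq | length-insert (Poke.coin p) as bs = unique⇒length≤ (unique M′) M′⊆
  where
  open Poke p
  M′⊆ : ∀ {z} → z ∈ˡ coins M′ → z ∈ˡ target ∷ as ++ bs
  M′⊆ z∈ with proj₁ result z∈
  ... | inj₁ (z∈M , coin≢z) = there (∈-remove as (coin≢z ∘ sym) (subst (_ ∈ˡ_) eq z∈M))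
  ... | inj₂ refl           = here refl

poke-minimum : ∀ {R M M′} → Poke R M M′ → Minimum M′
poke-minimum {M = M} {M′} p = minimum-resp M M′ (poke-span p) (poke-size p) (Poke.minimum p)

poke-hasSpan : ∀ {R M M′} → Poke R M M′ → HasSpan M′ R
poke-hasSpan p = ≐-trans (≐-sym (poke-span p)) (Poke.spans p)

-- Shadows of a walk on the axes; below and above are the extents of a
-- one-dimensional walk on the two sides of its start.

data Shift : Set where
  plus minus stay : Shift

shift : Shift → ℤ → ℤ
shift plus  = ℤ.suc
shift minus = ℤ.pred
shift stay  = id

below above pluses minuses : List Shift → ℕ

below []           = 0
below (plus ∷ ts)  = below ts ∸ 1
below (minus ∷ ts) = suc (below ts)
below (stay ∷ ts)  = below ts

above []           = 0
above (plus ∷ ts)  = suc (above ts)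
above (minus ∷ ts) = above ts ∸ 1
above (stay ∷ ts)  = above ts

pluses []           = 0
pluses (plus ∷ ts)  = suc (pluses ts)
pluses (minus ∷ ts) = pluses ts
pluses (stay ∷ ts)  = pluses ts

minuses []           = 0
minuses (plus ∷ ts)  = minuses ts
minuses (minus ∷ ts) = suc (minuses ts)
minuses (stay ∷ ts)  = minuses ts

width : List Shift → ℕ
width ts = below ts + above ts

-- The interval from i - a to i + b, with a moved across the inequality to avoid subtraction.
Between : ℤ → ℕ → ℕ → ℤ → Set
Between i a b z = i ℤ.≤ + a ℤ.+ z × z ℤ.≤ + b ℤ.+ i

suc-shuffle : ∀ n i → + suc n ℤ.+ i ≡ + n ℤ.+ ℤ.suc i
suc-shuffle n i = begin
  + suc n ℤ.+ i        ≡⟨ cong (λ m → + m ℤ.+ i) (ℕ.+-comm 1 n) ⟩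
  + n ℤ.+ 1ℤ ℤ.+ i     ≡⟨ ℤ.+-assoc (+ n) 1ℤ i ⟩
  + n ℤ.+ ℤ.suc i      ∎
  where open ≡-Reasoning

pred-shuffle : ∀ n i → + n ℤ.+ i ≡ + suc n ℤ.+ ℤ.pred i
pred-shuffle n i = sym (trans (suc-shuffle n (ℤ.pred i)) (cong (λ j → + n ℤ.+ j) (ℤ.suc-pred i)))

suc-cancel-≤ : ∀ {i j} → ℤ.suc i ℤ.≤ ℤ.suc j → i ℤ.≤ j
suc-cancel-≤ {i} {j} si≤sj = ℤ.≤-trans (ℤ.≤-reflexive (sym (ℤ.pred-suc i)))
  (ℤ.≤-trans (ℤ.pred-mono si≤sj) (ℤ.≤-reflexive (ℤ.pred-suc j)))

pred-≤⇒≤-suc : ∀ {i j} → ℤ.pred i ℤ.≤ j → i ℤ.≤ ℤ.suc j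
pred-≤⇒≤-suc {i} p = ℤ.≤-trans (ℤ.≤-reflexive (sym (ℤ.suc-pred i))) (ℤ.suc-mono p)

≤-suc⇒pred-≤ : ∀ {i j} → i ℤ.≤ ℤ.suc j → ℤ.pred i ℤ.≤ j
≤-suc⇒pred-≤ {j = j} p = ℤ.≤-trans (ℤ.pred-mono p) (ℤ.≤-reflexive (ℤ.pred-suc j))

-- The range after a first step `plus`, seen from the old start. The truncation in `a ∸ 1` matters
-- when `a` is 0: the range then begins at the old start itself.
Between-plus⁺ : ∀ {i z} a b → Between (ℤ.suc i) a b z → Between i (a ∸ 1) (suc b) z
Between-plus⁺ {i} {z} a b (lo , hi) = lower a lo , subst (z ℤ.≤_) (sym (suc-shuffle b i)) hi
  where
  lower : ∀ a → ℤ.suc i ℤ.≤ + a ℤ.+ z → i ℤ.≤ + (a ∸ 1) ℤ.+ z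
  lower zero    p = ℤ.≤-trans (ℤ.i≤suc[i] i) p
  lower (suc a) p = suc-cancel-≤ (subst (ℤ.suc i ℤ.≤_) (ℤ.suc-+ a z) p)

-- The range gains a point only when `a` is 0, and this point is the old start `i`.
Between-plus⁻ : ∀ {i z} a b → Between i (a ∸ 1) (suc b) z → z ≡ i ⊎ Between (ℤ.suc i) a b z
Between-plus⁻ {i} {z} a b (lo , hi) = lower a lo
  where
  hi′ = subst (z ℤ.≤_) (suc-shuffle b i) hi
  lower : ∀ a → i ℤ.≤ + (a ∸ 1) ℤ.+ z → z ≡ i ⊎ Between (ℤ.suc i) a b z
  lower zero    p with z ℤ.≟ i
  ... | yes z≡i = inj₁ z≡i
  ... | no  z≢i = inj₂ (subst (ℤ.suc i ℤ.≤_) (sym (ℤ.+-identityˡ z))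
                         (ℤ.i<j⇒suc[i]≤j (ℤ.≤∧≢⇒< (subst (i ℤ.≤_) (ℤ.+-identityˡ z) p) (z≢i ∘ sym))) , hi′)
  lower (suc a) p = inj₂ (subst (ℤ.suc i ℤ.≤_) (sym (ℤ.suc-+ a z)) (ℤ.suc-mono p) , hi′)

Between-minus⁺ : ∀ {i z} a b → Between (ℤ.pred i) a b z → Between i (suc a) (b ∸ 1) z
Between-minus⁺ {i} {z} a b (lo , hi) =
  subst (i ℤ.≤_) (sym (ℤ.suc-+ a z)) (pred-≤⇒≤-suc lo) , upper b hi
  where
  upper : ∀ b → z ℤ.≤ + b ℤ.+ ℤ.pred i → z ℤ.≤ + (b ∸ 1) ℤ.+ i
  upper zero    p = ℤ.≤-trans p (ℤ.+-monoʳ-≤ 0ℤ (ℤ.i≤j⇒pred[i]≤j (ℤ.≤-refl {i})))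
  upper (suc b) p = subst (z ℤ.≤_) (sym (pred-shuffle b i)) p

Between-minus⁻ : ∀ {i z} a b → Between i (suc a) (b ∸ 1) z → z ≡ i ⊎ Between (ℤ.pred i) a b z
Between-minus⁻ {i} {z} a b (lo , hi) = upper b hi
  where
  lo′ = ≤-suc⇒pred-≤ (subst (i ℤ.≤_) (ℤ.suc-+ a z) lo)
  upper : ∀ b → z ℤ.≤ + (b ∸ 1) ℤ.+ i → z ≡ i ⊎ Between (ℤ.pred i) a b z
  upper zero    p with z ℤ.≟ i
  ... | yes z≡i = inj₁ z≡i
  ... | no  z≢i = inj₂ (lo′ , subst (z ℤ.≤_) (sym (ℤ.+-identityˡ (ℤ.pred i)))
                         (ℤ.i<j⇒i≤pred[j] (ℤ.≤∧≢⇒< (subst (z ℤ.≤_) (ℤ.+-identityˡ i) p) z≢i)))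
  upper (suc b) p = inj₂ (lo′ , subst (z ℤ.≤_) (pred-shuffle b i) p)

Between-start : ∀ i a b → Between i a b i
Between-start i a b = ℤ.i≤j+i i (+ a) , ℤ.i≤j+i i (+ b)

path⇒Between : ∀ i ts {z} → z ∈ˡ path shift i ts → Between i (below ts) (above ts) z
path⇒Between i []           (here refl) = Between-start i 0 0
path⇒Between i (t ∷ ts)     (here refl) = Between-start i (below (t ∷ ts)) (above (t ∷ ts))
path⇒Between i (plus ∷ ts)  (there z∈)  = Between-plus⁺ (below ts) (above ts) (path⇒Between _ ts z∈)
path⇒Between i (minus ∷ ts) (there z∈)  = Between-minus⁺ (below ts) (above ts) (path⇒Between _ ts z∈)
path⇒Between i (stay ∷ ts)  (there z∈)  = path⇒Between _ ts z∈

-- Discrete intermediate value theorem: unit steps cannot jump over an integer.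
Between⇒path : ∀ i ts {z} → Between i (below ts) (above ts) z → z ∈ˡ path shift i ts
Between⇒path i [] {z} (lo , hi) = here (ℤ.≤-antisym
  (subst (z ℤ.≤_) (ℤ.+-identityˡ i) hi) (subst (i ℤ.≤_) (ℤ.+-identityˡ z) lo))
Between⇒path i (plus ∷ ts) z-between with Between-plus⁻ (below ts) (above ts) z-between
... | inj₁ refl = here refl
... | inj₂ z-between′ = there (Between⇒path _ ts z-between′)
Between⇒path i (minus ∷ ts) z-between with Between-minus⁻ (below ts) (above ts) z-between
... | inj₁ refl = here refl
... | inj₂ z-between′ = there (Between⇒path _ ts z-between′)
Between⇒path i (stay ∷ ts) z-between = there (Between⇒path _ ts z-between)

below≤minuses : ∀ ts → below ts ≤ minuses ts
below≤minuses []           = z≤n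
below≤minuses (plus ∷ ts)  = ℕ.≤-trans (ℕ.m∸n≤m (below ts) 1) (below≤minuses ts)
below≤minuses (minus ∷ ts) = s≤s (below≤minuses ts)
below≤minuses (stay ∷ ts)  = below≤minuses ts

above≤pluses : ∀ ts → above ts ≤ pluses ts
above≤pluses []           = z≤n
above≤pluses (plus ∷ ts)  = s≤s (above≤pluses ts)
above≤pluses (minus ∷ ts) = ℕ.≤-trans (ℕ.m∸n≤m (above ts) 1) (above≤pluses ts)
above≤pluses (stay ∷ ts)  = above≤pluses ts

-- Between its visits to the two extremes, the walk crosses the whole width in one direction, so one
-- kind of letter alone accounts for it. In the induction, a first `plus` widens the range only if
-- the rest never descends below its own start.
width≤ : ∀ ts → width ts ≤ pluses ts ⊔ minuses ts
width≤ []           = z≤n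
width≤ (plus ∷ ts)  with below ts | width≤ ts
... | zero  | _  = ℕ.≤-trans (s≤s (above≤pluses ts)) (ℕ.m≤m⊔n _ (minuses ts))
... | suc a | le = ℕ.≤-trans (ℕ.≤-reflexive (ℕ.+-suc a (above ts)))
                     (ℕ.≤-trans le (ℕ.⊔-monoˡ-≤ (minuses ts) (ℕ.n≤1+n (pluses ts))))
width≤ (minus ∷ ts) with above ts | width≤ ts
... | zero  | _  = ℕ.≤-trans (ℕ.≤-reflexive (ℕ.+-identityʳ _))
                     (ℕ.≤-trans (s≤s (below≤minuses ts)) (ℕ.m≤n⊔m (pluses ts) _))
... | suc b | le = ℕ.≤-trans (ℕ.≤-reflexive (sym (ℕ.+-suc (below ts) b)))
                     (ℕ.≤-trans le (ℕ.⊔-monoʳ-≤ (pluses ts) (ℕ.n≤1+n (minuses ts))))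
width≤ (stay ∷ ts)  = width≤ ts

OneWay : List Shift → Set
OneWay ts = minuses ts ≡ 0 ⊎ pluses ts ≡ 0

m+n≤m⊔n⇒0 : ∀ m n → m + n ≤ m ⊔ n → n ≡ 0 ⊎ m ≡ 0
m+n≤m⊔n⇒0 m n le with ℕ.≤-total m n
... | inj₁ m≤n rewrite ℕ.m≤n⇒m⊔n≡n m≤n =
  inj₂ (ℕ.n≤0⇒n≡0 (ℕ.+-cancelʳ-≤ n m 0 le))
... | inj₂ n≤m rewrite ℕ.m≥n⇒m⊔n≡m n≤m =
  inj₁ (ℕ.n≤0⇒n≡0 (ℕ.+-cancelˡ-≤ m n 0 (ℕ.≤-trans le (ℕ.≤-reflexive (sym (ℕ.+-identityʳ m))))))

widest⇒oneWay : ∀ ts → pluses ts + minuses ts ≤ width ts → OneWay ts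
widest⇒oneWay ts le = m+n≤m⊔n⇒0 (pluses ts) (minuses ts) (ℕ.≤-trans le (width≤ ts))

width≤pluses+minuses : ∀ ts → width ts ≤ pluses ts + minuses ts
width≤pluses+minuses ts = ℕ.≤-trans (width≤ ts) (ℕ.m⊔n≤m+n (pluses ts) (minuses ts))

displacement : ∀ i ts → + minuses ts ℤ.+ arrive shift i ts ≡ + pluses ts ℤ.+ i
displacement i []           = refl
displacement i (plus ∷ ts)  = trans (displacement _ ts) (sym (suc-shuffle (pluses ts) i))
displacement i (minus ∷ ts) = begin
  + suc (minuses ts) ℤ.+ e   ≡⟨ ℤ.suc-+ (minuses ts) e ⟩
  ℤ.suc (+ minuses ts ℤ.+ e) ≡⟨ cong ℤ.suc (displacement _ ts) ⟩
  ℤ.suc (+ pluses ts ℤ.+ ℤ.pred i) ≡⟨ ℤ.suc-+ (pluses ts) (ℤ.pred i) ⟨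
  + suc (pluses ts) ℤ.+ ℤ.pred i   ≡⟨ pred-shuffle (pluses ts) i ⟨
  + pluses ts ℤ.+ i ∎
  where
  open ≡-Reasoning
  e = arrive shift (ℤ.pred i) ts
displacement i (stay ∷ ts)  = displacement _ ts

-- Walks in the plane and their bounding boxes

horizontally vertically : Direction → Shift

horizontally left  = minus
horizontally right = plus
horizontally up    = stay
horizontally down  = stay

vertically left  = stay
vertically right = stay
vertically up    = plus
vertically down  = minus

xs ys : List Direction → List Shift
xs = map horizontally
ys = map vertically

proj₁-move : ∀ d p → proj₁ (move d p) ≡ shift (horizontally d) (proj₁ p)
proj₁-move left  p = refl
proj₁-move right p = refl
proj₁-move up    p = refl
proj₁-move down  p = refl

proj₂-move : ∀ d p → proj₂ (move d p) ≡ shift (vertically d) (proj₂ p)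
proj₂-move left  p = refl
proj₂-move right p = refl
proj₂-move up    p = refl
proj₂-move down  p = refl

length-word : ∀ w → length w ≡ (pluses (xs w) + minuses (xs w)) + (pluses (ys w) + minuses (ys w))
length-word []          = refl
length-word (left ∷ w)  rewrite ℕ.+-suc (pluses (xs w)) (minuses (xs w)) = cong suc (length-word w)
length-word (right ∷ w) = cong suc (length-word w)
length-word (up ∷ w)    rewrite ℕ.+-suc (pluses (xs w) + minuses (xs w)) (pluses (ys w) + minuses (ys w)) =
  cong suc (length-word w)
length-word (down ∷ w)  rewrite ℕ.+-suc (pluses (ys w)) (minuses (ys w))
                              | ℕ.+-suc (pluses (xs w) + minuses (xs w)) (pluses (ys w) + minuses (ys w)) =
  cong suc (length-word w)

Hull : Position → List Direction → Pred Position _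
Hull p w (x , y) = Between (proj₁ p) (below (xs w)) (above (xs w)) x
                 × Between (proj₂ p) (below (ys w)) (above (ys w)) y

path⊆Hull : ∀ p w {q} → q ∈ˡ path move p w → q ∈ Hull p w
path⊆Hull p w q∈ =
  path⇒Between _ (xs w) (subst (_ ∈ˡ_) (map-path proj₁ horizontally proj₁-move p w) (∈-map⁺ proj₁ q∈)) ,
  path⇒Between _ (ys w) (subst (_ ∈ˡ_) (map-path proj₂ vertically proj₂-move p w) (∈-map⁺ proj₂ q∈))

Between-convex : ∀ {i a b z} → Between i a b (ℤ.pred z) → Between i a b (ℤ.suc z) → Between i a b z
Between-convex {a = a} {z = z} (lo , _) (_ , hi) =
  ℤ.≤-trans lo (ℤ.+-monoʳ-≤ (+ a) (ℤ.i≤j⇒pred[i]≤j (ℤ.≤-refl {z}))) , ℤ.≤-trans (ℤ.i≤suc[i] z) hi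

-- Two distinct neighbours lie either on opposite sides, where an interval is convex, or in
-- perpendicular directions, where each supplies the coordinate that it shares with the position.
Hull-closed : ∀ p w → Closed (Hull p w)
Hull-closed p w (q , r , q≢r , p~q , p~r , q∈ , r∈) with adjacent⇒move p~q | adjacent⇒move p~r
... | left  , refl | left  , refl = ⊥-elim (q≢r refl)
... | left  , refl | right , refl = Between-convex (proj₁ q∈) (proj₁ r∈) , proj₂ q∈
... | left  , refl | up    , refl = proj₁ r∈ , proj₂ q∈
... | left  , refl | down  , refl = proj₁ r∈ , proj₂ q∈
... | right , refl | left  , refl = Between-convex (proj₁ r∈) (proj₁ q∈) , proj₂ q∈
... | right , refl | right , refl = ⊥-elim (q≢r refl)
... | right , refl | up    , refl = proj₁ r∈ , proj₂ q∈
... | right , refl | down  , refl = proj₁ r∈ , proj₂ q∈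
... | up    , refl | left  , refl = proj₁ q∈ , proj₂ r∈
... | up    , refl | right , refl = proj₁ q∈ , proj₂ r∈
... | up    , refl | up    , refl = ⊥-elim (q≢r refl)
... | up    , refl | down  , refl = proj₁ q∈ , Between-convex (proj₂ r∈) (proj₂ q∈)
... | down  , refl | left  , refl = proj₁ q∈ , proj₂ r∈
... | down  , refl | right , refl = proj₁ q∈ , proj₂ r∈
... | down  , refl | up    , refl = proj₁ q∈ , Between-convex (proj₂ q∈) (proj₂ r∈)
... | down  , refl | down  , refl = ⊥-elim (q≢r refl)

module Fill {P : Position → Set} (closed : Closed P) where

  -- The column at `x` fills along the walk: each new position has one neighbour just reached in its
  -- own column and another beside it in the full column at `x′`.
  fill-column : ∀ {x x′} → x ≢ x′ → (∀ y → Adjacent (x , y) (x′ , y)) → ∀ p w → P (x , proj₂ p) →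
                (∀ {q} → q ∈ˡ path move p w → P (x′ , proj₂ q)) →
                ∀ {q} → q ∈ˡ path move p w → P (x , proj₂ q)
  fill-column {x} {x′} x≢x′ x~x′ = path-induction move extend
    where
    extend : ∀ d {q} → P (x , proj₂ q) → P (x′ , proj₂ (move d q)) → P (x , proj₂ (move d q))
    extend left  P₁ P₂ = P₁
    extend right P₁ P₂ = P₁
    extend up    P₁ P₂ = between-closed closed (adjacent-sym (adjacent-move up _)) (x~x′ _)
                           (x≢x′ ∘ cong proj₁) P₁ P₂
    extend down  P₁ P₂ = between-closed closed (adjacent-sym (adjacent-move down _)) (x~x′ _)
                           (x≢x′ ∘ cong proj₁) P₁ P₂

  fill-row : ∀ {y y′} → y ≢ y′ → (∀ x → Adjacent (x , y) (x , y′)) → ∀ p w → P (proj₁ p , y) →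
             (∀ {q} → q ∈ˡ path move p w → P (proj₁ q , y′)) →
             ∀ {q} → q ∈ˡ path move p w → P (proj₁ q , y)
  fill-row {y} {y′} y≢y′ y~y′ = path-induction move extend
    where
    extend : ∀ d {q} → P (proj₁ q , y) → P (proj₁ (move d q) , y′) → P (proj₁ (move d q) , y)
    extend up    P₁ P₂ = P₁
    extend down  P₁ P₂ = P₁
    extend left  P₁ P₂ = between-closed closed (adjacent-sym (adjacent-move left _)) (y~y′ _)
                           (y≢y′ ∘ cong proj₂) P₁ P₂
    extend right P₁ P₂ = between-closed closed (adjacent-sym (adjacent-move right _)) (y~y′ _)
                           (y≢y′ ∘ cong proj₂) P₁ P₂

  -- Induction on the walk: the column of the first point is adjacent or equal to
  -- that of the second, which is already filled, and fills up alongside it.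
  fill : ∀ p w → (∀ {q} → q ∈ˡ path move p w → P q) →
         ∀ {u v} → u ∈ˡ path move p w → v ∈ˡ path move p w → P (proj₁ u , proj₂ v)
  fill p []      P∋ (here refl) (here refl) = P∋ (here refl)
  fill p (d ∷ w) P∋ (here refl) (here refl) = P∋ (here refl)
  fill p (d ∷ w) P∋ (there u∈)  (there v∈)  = fill (move d p) w (P∋ ∘ there) u∈ v∈
  fill p (d ∷ w) P∋ (here refl) (there v∈)  = column d P∋ v∈
    where
    column : ∀ d → (∀ {q} → q ∈ˡ path move p (d ∷ w) → P q) →
             ∀ {v} → v ∈ˡ path move (move d p) w → P (proj₁ p , proj₂ v)
    column left  P∋ = fill-column i≢pred[i] (λ y → adjacent-move left (_ , y)) _ w (P∋ (here refl))
                        (fill _ w (P∋ ∘ there) (start∈path move _ w))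
    column right P∋ = fill-column ℤ.i≢suc[i] (λ y → adjacent-move right (_ , y)) _ w (P∋ (here refl))
                        (fill _ w (P∋ ∘ there) (start∈path move _ w))
    column up    P∋ = fill _ w (P∋ ∘ there) (start∈path move _ w)
    column down  P∋ = fill _ w (P∋ ∘ there) (start∈path move _ w)
  fill p (d ∷ w) P∋ (there u∈)  (here refl) = row d P∋ u∈
    where
    row : ∀ d → (∀ {q} → q ∈ˡ path move p (d ∷ w) → P q) →
          ∀ {u} → u ∈ˡ path move (move d p) w → P (proj₁ u , proj₂ p)
    row up    P∋ = fill-row ℤ.i≢suc[i] (λ x → adjacent-move up (x , _)) _ w (P∋ (here refl))
                     (λ u∈ → fill _ w (P∋ ∘ there) u∈ (start∈path move _ w))
    row down  P∋ = fill-row i≢pred[i] (λ x → adjacent-move down (x , _)) _ w (P∋ (here refl))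
                     (λ u∈ → fill _ w (P∋ ∘ there) u∈ (start∈path move _ w))
    row left  P∋ u∈ = fill _ w (P∋ ∘ there) u∈ (start∈path move _ w)
    row right P∋ u∈ = fill _ w (P∋ ∘ there) u∈ (start∈path move _ w)

  Hull⊆ : ∀ p w → (∀ {q} → q ∈ˡ path move p w → P q) → Hull p w ⊆ P
  Hull⊆ p w P∋ (x-between , y-between)
    with ∈-map⁻ proj₁ (subst (_ ∈ˡ_) (sym (map-path proj₁ horizontally proj₁-move p w))
                         (Between⇒path _ (xs w) x-between))
       | ∈-map⁻ proj₂ (subst (_ ∈ˡ_) (sym (map-path proj₂ vertically proj₂-move p w))
                         (Between⇒path _ (ys w) y-between))
  ... | u , u∈ , refl | v , v∈ , refl = fill p w P∋ u∈ v∈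

-- A chain is encoded by its first coin and the steps to the following coins,
-- the coin reached by two d e being at distance 2 whenever e ≢ opposite d.

data Step : Set where
  one : Direction → Step
  two : Direction → Direction → Step

advance : Step → Position → Position
advance (one d)   = move d
advance (two d e) = move e ∘ move d

word : List Step → List Direction
word []             = []
word (one d ∷ ss)   = d ∷ word ss
word (two d e ∷ ss) = d ∷ e ∷ word ss

arrive-word : ∀ p ss → arrive move p (word ss) ≡ arrive advance p ss
arrive-word p []             = refl
arrive-word p (one d ∷ ss)   = arrive-word _ ss
arrive-word p (two d e ∷ ss) = arrive-word _ ss

coins⊆path : ∀ p ss {q} → q ∈ˡ path advance p ss → q ∈ˡ path move p (word ss)
coins⊆path p []             q∈          = q∈
coins⊆path p (one d ∷ ss)   (here refl) = here refl
coins⊆path p (one d ∷ ss)   (there q∈)  = there (coins⊆path _ ss q∈)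
coins⊆path p (two d e ∷ ss) (here refl) = here refl
coins⊆path p (two d e ∷ ss) (there q∈)  = there (there (coins⊆path _ ss q∈))

-- The position skipped by a `two` step is adjacent to the coins at both ends of the step, and these
-- differ because the chain has no repetition.
path⊆closed : ∀ {P} → Closed P → ∀ p ss → Unique (path advance p ss) →
              (∀ {q} → q ∈ˡ path advance p ss → P q) → ∀ {q} → q ∈ˡ path move p (word ss) → P q
path⊆closed closed p []             ss! P∋ q∈                  = P∋ q∈
path⊆closed closed p (one d ∷ ss)   ss! P∋ (here refl)         = P∋ (here refl)
path⊆closed closed p (one d ∷ ss)   (_ ∷ ss!) P∋ (there q∈)    = path⊆closed closed _ ss ss! (P∋ ∘ there) q∈
path⊆closed closed p (two d e ∷ ss) ss! P∋ (here refl)         = P∋ (here refl)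
path⊆closed closed p (two d e ∷ ss) ss! P∋ (there (here refl)) =
  between-closed closed (adjacent-sym (adjacent-move d p)) (adjacent-move e (move d p))
    (λ eq → ∉-tail ss! (subst (_∈ˡ path advance (move e (move d p)) ss) (sym eq) (start∈path advance _ ss)))
    (P∋ (here refl)) (P∋ (there (start∈path advance _ ss)))
path⊆closed closed p (two d e ∷ ss) (_ ∷ ss!) P∋ (there (there q∈)) =
  path⊆closed closed _ ss ss! (P∋ ∘ there) q∈

-- The box is closed and contains the coins; conversely, the closed set `span C` contains the
-- skipped positions, hence the whole walk, hence the box.
span-chain : ∀ C p ss → Unique (path advance p ss) → ⟦ C ⟧ ≐ (_∈ˡ path advance p ss) →
             span C ≐ Hull p (word ss)
span-chain C p ss ss! (C⊆ , C⊇) =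
  span-least C (Hull-closed p (word ss)) (path⊆Hull p (word ss) ∘ coins⊆path p ss ∘ C⊆) ,
  Fill.Hull⊆ (span-closed C) p (word ss) (path⊆closed (span-closed C) p ss ss! (coins⊆span C ∘ C⊇))

singles : List Step → ℕ
singles []             = 0
singles (one d ∷ ss)   = suc (singles ss)
singles (two d e ∷ ss) = singles ss

colour-constant : ∀ p ss → singles ss ≡ 0 → ∀ {q} → q ∈ˡ path advance p ss → colour q ≡ colour p
colour-constant p []             none (here refl) = refl
colour-constant p (two d e ∷ ss) none (here refl) = refl
colour-constant p (two d e ∷ ss) none (there q∈)  = begin
  _                        ≡⟨ colour-constant _ ss none q∈ ⟩
  colour (move e (move d p)) ≡⟨ colour-move e (move d p) ⟩
  colour (move d p) ⁻¹     ≡⟨ cong _⁻¹ (colour-move d p) ⟩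
  (colour p ⁻¹) ⁻¹         ≡⟨ ⁻¹-involutive (colour p) ⟩
  colour p                 ∎
  where open ≡-Reasoning

adjacent⇒≢ : ∀ {p q} → Adjacent p q → p ≢ q
adjacent⇒≢ adj refl = p≢p⁻¹ (adjacent⇒colour adj)

no-adjacent : ∀ p ss → singles ss ≡ 0 → ∀ {q r} →
              q ∈ˡ path advance p ss → r ∈ˡ path advance p ss → ¬ Adjacent q r
no-adjacent p ss none q∈ r∈ adj =
  p≢p⁻¹ (trans (trans (colour-constant p ss none q∈) (sym (colour-constant p ss none r∈)))
               (adjacent⇒colour adj))

-- Regrouping the letters of a word into steps

infix 4 _⇝_
-- `forth` and `back` regroup three letters, which displaces the coin between the two steps; `flip`
-- changes letters but no coin.
data _⇝_ : List Step → List Step → Set where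
  forth : ∀ {a b c ss} → one a ∷ two b c ∷ ss ⇝ two a b ∷ one c ∷ ss
  back  : ∀ {a b c ss} → two a b ∷ one c ∷ ss ⇝ one a ∷ two b c ∷ ss
  flip  : ∀ {a b ss} → two a b ∷ ss ⇝ two b a ∷ ss
  there : ∀ {s ss ts} → ss ⇝ ts → s ∷ ss ⇝ s ∷ ts

⇝-sym : ∀ {ss ts} → ss ⇝ ts → ts ⇝ ss
⇝-sym forth     = back
⇝-sym back      = forth
⇝-sym flip      = flip
⇝-sym (there m) = there (⇝-sym m)

⇝⇒↭ : ∀ {ss ts} → ss ⇝ ts → word ss ↭ word ts
⇝⇒↭ forth               = ↭-refl
⇝⇒↭ back                = ↭-refl
⇝⇒↭ flip                = ↭-swap _ _ ↭-refl
⇝⇒↭ (there {one d} m)   = ↭-prep d (⇝⇒↭ m)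
⇝⇒↭ (there {two d e} m) = ↭-prep d (↭-prep e (⇝⇒↭ m))

⇝*-there : ∀ {s ss ts} → Star _⇝_ ss ts → Star _⇝_ (s ∷ ss) (s ∷ ts)
⇝*-there = gmap _ there

group : List Direction → List Step
group []          = []
-- This clause serves staircases of odd length; in `solo`, an odd word leaves an even rest to be
-- paired.
group (d ∷ [])    = one d ∷ []
group (d ∷ e ∷ w) = two d e ∷ group w

-- For an odd word, the normal form with its single letter in front.
solo : List Direction → List Step
solo []      = []
solo (d ∷ w) = one d ∷ group w

group-word : ∀ ss → singles ss ≡ 0 → group (word ss) ≡ ss
group-word []             none = refl
group-word (two d e ∷ ss) none = cong (two d e ∷_) (group-word ss none)

parity-word : ∀ ss → parity (length (word ss)) ≡ parity (singles ss)
parity-word []             = refl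
parity-word (one d ∷ ss)   = begin
  parity (suc (length (word ss))) ≡⟨ parity-suc (length (word ss)) ⟩
  parity (length (word ss)) ⁻¹    ≡⟨ cong _⁻¹ (parity-word ss) ⟩
  parity (singles ss) ⁻¹          ≡⟨ parity-suc (singles ss) ⟨
  parity (suc (singles ss))       ∎
  where open ≡-Reasoning
parity-word (two d e ∷ ss) = parity-word ss

Odd Even : List Direction → Set
Odd w  = parity (length w) ≡ 1ℙ
Even w = parity (length w) ≡ 0ℙ

odd-∷⁻ : ∀ d w → Odd (d ∷ w) → Even w
odd-∷⁻ d w odd = ⁻¹-injective (trans (sym (parity-suc (length w))) odd)

even-∷⁻ : ∀ d w → Even (d ∷ w) → Odd w
even-∷⁻ d w even = ⁻¹-injective (trans (sym (parity-suc (length w))) even)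

parity-↭ : ∀ {w w′ : List Direction} {p} → w ↭ w′ → parity (length w) ≡ p → parity (length w′) ≡ p
parity-↭ w↭w′ eq = trans (cong parity (sym (↭-length w↭w′))) eq

solo-forth : ∀ {a b} w → Odd w → solo (a ∷ b ∷ w) ⇝ two a b ∷ solo w
solo-forth (c ∷ w) odd = forth

-- From the front, the single letter travels across the pairs by `forth` until it reaches its place
-- in `ss`. Normal forms thus serve as hubs, and only they remain to be connected.
solo⇝*word : ∀ ss → singles ss ≡ 1 → Star _⇝_ (solo (word ss)) ss
solo⇝*word (one d ∷ ss)   one! rewrite group-word ss (ℕ.suc-injective one!) = ε
solo⇝*word (two d e ∷ ss) one! =
  solo-forth (word ss) (trans (parity-word ss) (cong parity one!)) ◅ ⇝*-there (solo⇝*word ss one!)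

-- The single step can be moved out of the way, so that any two consecutive
-- letters of the word can be made to form one step, which then may be flipped.
mutual
  solo-odd : ∀ {w w′} → w ↭ w′ → Odd w → Star _⇝_ (solo w) (solo w′)
  solo-odd refl odd = ε
  solo-odd (prep {w} x w↭w′) odd = solo-even x w↭w′ (odd-∷⁻ x w odd)
  solo-odd (swap {w} x y w↭w′) odd =
    solo-forth w odd ◅ flip ◅ ⇝*-there (solo-odd w↭w′ odd) ◅◅
    ⇝-sym (solo-forth _ (parity-↭ w↭w′ odd)) ◅ ε
  solo-odd (_↭_.trans w↭w′ w′↭w″) odd = solo-odd w↭w′ odd ◅◅ solo-odd w′↭w″ (parity-↭ w↭w′ odd)

  solo-even : ∀ x {w w′} → w ↭ w′ → Even w → Star _⇝_ (solo (x ∷ w)) (solo (x ∷ w′))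
  solo-even x refl even = ε
  solo-even x (prep {w} y w↭w′) even =
    solo-forth w odd ◅ ⇝*-there (solo-odd w↭w′ odd) ◅◅
    ⇝-sym (solo-forth _ (parity-↭ w↭w′ odd)) ◅ ε
    where odd = even-∷⁻ y w even
  solo-even x (swap {w} {w′} y z w↭w′) even =
    there flip ◅ solo-forth (y ∷ w) odd ◅ ⇝*-there (solo-even y w↭w′ even) ◅◅
    ⇝-sym (solo-forth (y ∷ w′) (parity-↭ (↭-prep y w↭w′) odd)) ◅ ε
    where odd = trans (parity-suc (length w)) (cong _⁻¹ even)
  solo-even x (_↭_.trans w↭w′ w′↭w″) even = solo-even x w↭w′ even ◅◅ solo-even x w′↭w″ (parity-↭ w↭w′ even)

connected : ∀ {ss ts} → singles ss ≡ 1 → singles ts ≡ 1 → word ss ↭ word ts → Star _⇝_ ss ts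
connected {ss} {ts} ss! ts! ss↭ts =
  reverse ⇝-sym (solo⇝*word ss ss!) ◅◅
  solo-odd ss↭ts (trans (parity-word ss) (cong parity ss!)) ◅◅ solo⇝*word ts ts!

-- Heights and monotone chains

suc-pred-comm : ∀ i → ℤ.suc (ℤ.pred i) ≡ ℤ.pred (ℤ.suc i)
suc-pred-comm i = trans (ℤ.suc-pred i) (sym (ℤ.pred-suc i))

move-comm : ∀ d e p → move d (move e p) ≡ move e (move d p)
move-comm left  left  p = refl
move-comm left  right p = cong (_, proj₂ p) (sym (suc-pred-comm (proj₁ p)))
move-comm left  up    p = refl
move-comm left  down  p = refl
move-comm right left  p = cong (_, proj₂ p) (suc-pred-comm (proj₁ p))
move-comm right right p = refl
move-comm right up    p = refl
move-comm right down  p = refl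
move-comm up    left  p = refl
move-comm up    right p = refl
move-comm up    up    p = refl
move-comm up    down  p = cong (proj₁ p ,_) (suc-pred-comm (proj₂ p))
move-comm down  left  p = refl
move-comm down  right p = refl
move-comm down  up    p = cong (proj₁ p ,_) (sym (suc-pred-comm (proj₂ p)))
move-comm down  down  p = refl

+-cancelʳ : ∀ i j k → j ℤ.+ i ≡ k ℤ.+ i → j ≡ k
+-cancelʳ = ∙-cancelʳ (AbelianGroup.group ℤ.+-0-abelianGroup)

replace-second : ∀ {A : Set} {a x y : A} {zs zs′} → zs ≡ zs′ → Replace x y (a ∷ x ∷ zs) (a ∷ y ∷ zs′)
replace-second refl = there here

IsUnit : ℤ → Set
IsUnit i = i ≡ 1ℤ ⊎ i ≡ -1ℤ

-unit : ∀ {i} → IsUnit i → IsUnit (ℤ.- i)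
-unit (inj₁ refl) = inj₂ refl
-unit (inj₂ refl) = inj₁ refl

units-sum : ∀ {i j} n → IsUnit i → IsUnit j → i ℤ.+ j ≡ + suc (suc n) → i ≡ 1ℤ × j ≡ 1ℤ × n ≡ 0
units-sum n (inj₁ refl) (inj₁ refl) refl = refl , refl , refl
units-sum n (inj₁ refl) (inj₂ refl) ()
units-sum n (inj₂ refl) (inj₁ refl) ()
units-sum n (inj₂ refl) (inj₂ refl) ()

colour-two-apart : ∀ {p q r} → Adjacent p q → Adjacent q r → colour r ≡ colour p
colour-two-apart p~q q~r = trans (adjacent⇒colour q~r)
  (trans (cong _⁻¹ (adjacent⇒colour p~q)) (⁻¹-involutive _))

linked-∷ : ∀ {R : Position → Position → Set} {p q} ss → R p q → Linked R (path advance q ss) →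
           Linked R (p ∷ path advance q ss)
linked-∷ []       Rpq linked = Rpq ∷ linked
linked-∷ (_ ∷ ss) Rpq linked = Rpq ∷ linked

-- The linear form s x + t y increases along a chain all of whose moves lie in
-- the quadrant with signs s and t.
module Quadrant (s t : ℤ) (unit-s : IsUnit s) (unit-t : IsUnit t) where

  height : Position → ℤ
  height (x , y) = s ℤ.* x ℤ.+ t ℤ.* y

  slope : Direction → ℤ
  slope left  = ℤ.- s
  slope right = s
  slope up    = t
  slope down  = ℤ.- t

  slope-unit : ∀ d → IsUnit (slope d)
  slope-unit left  = -unit unit-s
  slope-unit right = unit-s
  slope-unit up    = unit-t
  slope-unit down  = -unit unit-t

  height-move : ∀ d p → height (move d p) ≡ slope d ℤ.+ height p
  height-move left  (x , y) = lemma s t x y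
    where
    lemma : ∀ s t x y → s ℤ.* (-1ℤ ℤ.+ x) ℤ.+ t ℤ.* y ≡ ℤ.- s ℤ.+ (s ℤ.* x ℤ.+ t ℤ.* y)
    lemma = solve-∀
  height-move right (x , y) = lemma s t x y
    where
    lemma : ∀ s t x y → s ℤ.* (1ℤ ℤ.+ x) ℤ.+ t ℤ.* y ≡ s ℤ.+ (s ℤ.* x ℤ.+ t ℤ.* y)
    lemma = solve-∀
  height-move up    (x , y) = lemma s t x y
    where
    lemma : ∀ s t x y → s ℤ.* x ℤ.+ t ℤ.* (1ℤ ℤ.+ y) ≡ t ℤ.+ (s ℤ.* x ℤ.+ t ℤ.* y)
    lemma = solve-∀
  height-move down  (x , y) = lemma s t x y
    where
    lemma : ∀ s t x y → s ℤ.* x ℤ.+ t ℤ.* (-1ℤ ℤ.+ y) ≡ ℤ.- t ℤ.+ (s ℤ.* x ℤ.+ t ℤ.* y)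
    lemma = solve-∀

  infix 4 _above_by_
  -- A record keeps both positions and the gap recoverable from the type, unlike the unfolded
  -- equation between heights.
  record _above_by_ (q p : Position) (n : ℕ) : Set where
    constructor above-by
    field gap : height q ≡ + n ℤ.+ height p

  open _above_by_

  self-above : ∀ p → p above p by 0
  self-above p = above-by (sym (ℤ.+-identityˡ (height p)))

  above-functional : ∀ {p q m n} → q above p by m → q above p by n → m ≡ n
  above-functional {p} eq eq′ =
    ℤ.+-injective (+-cancelʳ (height p) _ _ (trans (sym (gap eq)) (gap eq′)))

  above-move : ∀ d {p q n} → slope d ≡ 1ℤ → q above move d p by n → q above p by suc n
  above-move d {p} {q} {n} d↑ eq = above-by (begin
    height q                           ≡⟨ gap eq ⟩
    + n ℤ.+ height (move d p)          ≡⟨ cong (λ i → + n ℤ.+ i) (height-move d p) ⟩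
    + n ℤ.+ (slope d ℤ.+ height p)     ≡⟨ cong (λ i → + n ℤ.+ (i ℤ.+ height p)) d↑ ⟩
    + n ℤ.+ ℤ.suc (height p)           ≡⟨ suc-shuffle n (height p) ⟨
    + suc n ℤ.+ height p               ∎)
    where open ≡-Reasoning

  above⇒≢ : ∀ {p q n} → q above p by suc n → p ≢ q
  above⇒≢ {p} eq refl with () ← above-functional (self-above p) eq

  above⇒¬adjacent : ∀ {p q n} → q above p by suc (suc n) → ¬ Adjacent p q
  above⇒¬adjacent {p} {q} {n} q↑ adj with adjacent⇒move adj
  ... | d , refl = not-unit (slope-unit d)
                     (+-cancelʳ (height p) (slope d) _ (trans (sym (height-move d p)) (gap q↑)))
    where
    not-unit : ∀ {i} → IsUnit i → i ≢ + suc (suc n)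
    not-unit (inj₁ refl) ()
    not-unit (inj₂ refl) ()

  -- Every slope is 1 or -1, so two moves rise by two or more only if each rises by exactly one.
  two-moves : ∀ {d e p n} → move e (move d p) above p by suc (suc n) →
              slope d ≡ 1ℤ × slope e ≡ 1ℤ × n ≡ 0
  two-moves {d} {e} {p} {n} eq = let e↑ , d↑ , n≡0 = units-sum n (slope-unit e) (slope-unit d) sum in
                                 d↑ , e↑ , n≡0
    where
    open ≡-Reasoning
    sum : slope e ℤ.+ slope d ≡ + suc (suc n)
    sum = +-cancelʳ (height p) _ _ (begin
      (slope e ℤ.+ slope d) ℤ.+ height p   ≡⟨ ℤ.+-assoc (slope e) (slope d) (height p) ⟩
      slope e ℤ.+ (slope d ℤ.+ height p)   ≡⟨ cong (λ i → slope e ℤ.+ i) (height-move d p) ⟨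
      slope e ℤ.+ height (move d p)        ≡⟨ height-move e (move d p) ⟨
      height (move e (move d p))           ≡⟨ gap eq ⟩
      + suc (suc n) ℤ.+ height p           ∎)

  Ascending : List Direction → Set
  Ascending = All (λ d → slope d ≡ 1ℤ)

  path-above : ∀ p ss → Ascending (word ss) → ∀ {q} → q ∈ˡ path advance p ss → ∃ λ n → q above p by n
  path-above p []             _               (here refl) = 0 , self-above p
  path-above p (one d ∷ ss)   _               (here refl) = 0 , self-above p
  path-above p (one d ∷ ss)   (d↑ ∷ asc)      (there q∈)  with path-above _ ss asc q∈
  ... | n , eq = suc n , above-move d d↑ eq
  path-above p (two d e ∷ ss) _               (here refl) = 0 , self-above p
  path-above p (two d e ∷ ss) (d↑ ∷ e↑ ∷ asc) (there q∈)  with path-above _ ss asc q∈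
  ... | n , eq = suc (suc n) , above-move d d↑ (above-move e e↑ eq)

  tail-above : ∀ p s ss → Ascending (word (s ∷ ss)) → ∀ {q} → q ∈ˡ path advance (advance s p) ss →
               ∃ λ n → q above p by suc n
  tail-above p (one d)   ss (d↑ ∷ asc)      q∈ with path-above _ ss asc q∈
  ... | n , eq = n , above-move d d↑ eq
  tail-above p (two d e) ss (d↑ ∷ e↑ ∷ asc) q∈ with path-above _ ss asc q∈
  ... | n , eq = suc n , above-move d d↑ (above-move e e↑ eq)

  ascending⇒unique : ∀ p ss → Ascending (word ss) → Unique (path advance p ss)
  ascending⇒unique p []             asc                = [] ∷ []
  ascending⇒unique p (one d ∷ ss)   (d↑ ∷ asc)         =
    All.tabulate (λ q∈ → above⇒≢ (proj₂ (tail-above p (one d) ss (d↑ ∷ asc) q∈))) ∷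
    ascending⇒unique _ ss asc
  ascending⇒unique p (two d e ∷ ss) (d↑ ∷ e↑ ∷ asc)    =
    All.tabulate (λ q∈ → above⇒≢ (proj₂ (tail-above p (two d e) ss (d↑ ∷ e↑ ∷ asc) q∈))) ∷
    ascending⇒unique _ ss asc

  level⇒start : ∀ p ss → Ascending (word ss) → ∀ {q} → q ∈ˡ path advance p ss → q above p by 0 → q ≡ p
  level⇒start p []       asc (here refl) eq = refl
  level⇒start p (s ∷ ss) asc (here refl) eq = refl
  level⇒start p (s ∷ ss) asc (there q∈)  eq
    with () ← above-functional eq (proj₂ (tail-above p s ss asc q∈))

  dist-one : ∀ d p → Dist p (move d p) 1
  dist-one d p = step (adjacent-move d p) stop , least
    where
    least : ∀ k → Walk k p (move d p) → 1 ≤ k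
    least (suc k) _ = s≤s z≤n
    least zero walk = ⊥-elim (no-walk walk refl)
      where
      -- The end is a variable here because `p` and `move d p` do not unify when `stop` is matched.
      no-walk : ∀ {q} → Walk 0 p q → q ≢ move d p
      no-walk stop = adjacent⇒≢ (adjacent-move d p)

  -- A walk of length at most one changes the height by at most one, which excludes a shorter walk.
  dist-two : ∀ d e p → slope d ≡ 1ℤ → slope e ≡ 1ℤ → Dist p (move e (move d p)) 2
  dist-two d e p d↑ e↑ = step (adjacent-move d p) (step (adjacent-move e (move d p)) stop) , least
    where
    q : Position
    q = move e (move d p)
    q-above : q above p by 2
    q-above = above-move d d↑ (above-move e e↑ (self-above q))
    least : ∀ k → Walk k p q → 2 ≤ k
    least (suc (suc k)) _ = s≤s (s≤s z≤n)
    least zero walk = ⊥-elim (no-walk walk refl)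
      where
      no-walk : ∀ {r} → Walk 0 p r → r ≢ q
      no-walk stop = above⇒≢ q-above
    least (suc zero) walk = ⊥-elim (no-walk walk refl)
      where
      no-walk : ∀ {r} → Walk 1 p r → r ≢ q
      no-walk (step adj stop) refl = above⇒¬adjacent q-above adj

  ascending⇒linked : ∀ p ss → Ascending (word ss) →
                     Linked (λ p q → Dist p q 1 ⊎ Dist p q 2) (path advance p ss)
  ascending⇒linked p []             asc             = [-]
  ascending⇒linked p (one d ∷ ss)   (d↑ ∷ asc)      =
    linked-∷ ss (inj₁ (dist-one d p)) (ascending⇒linked _ ss asc)
  ascending⇒linked p (two d e ∷ ss) (d↑ ∷ e↑ ∷ asc) =
    linked-∷ ss (inj₂ (dist-two d e p d↑ e↑)) (ascending⇒linked _ ss asc)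

  -- Comparing heights, the adjacent pair is the unique step of length one, the
  -- supporting coin is the neighbour of the poked coin across a step of length
  -- two, and the target divides that step; in particular no end coin is poked.
  poke-steps : ∀ p ss → singles ss ≡ 1 → Ascending (word ss) → ∀ {coin partner target q} →
               coin ∈ˡ path advance p ss → partner ∈ˡ path advance p ss → Adjacent coin partner →
               Adjacent coin target → q ∈ˡ path advance p ss → q ≢ coin → Adjacent target q →
               ∃ λ ts → singles ts ≡ 1 × Ascending (word ts) × arrive advance p ts ≡ arrive advance p ss ×
                        Replace coin target (path advance p ss) (path advance p ts)
  poke-steps p (two a b ∷ ss) one! asc (here refl) (here refl) pair _ _ _ _ = ⊥-elim (adjacent⇒≢ pair refl)
  poke-steps p (two a b ∷ ss) one! (a↑ ∷ b↑ ∷ asc) (here refl) (there partner∈) pair _ _ _ _ =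
    ⊥-elim (above⇒¬adjacent (above-move a a↑ (above-move b b↑ (proj₂ (path-above _ ss asc partner∈)))) pair)
  poke-steps p (two a b ∷ ss) one! (a↑ ∷ b↑ ∷ asc) (there coin∈) (here refl) pair _ _ _ _ =
    ⊥-elim (above⇒¬adjacent (above-move a a↑ (above-move b b↑ (proj₂ (path-above _ ss asc coin∈))))
                            (adjacent-sym pair))
  poke-steps p (two a b ∷ ss) one! (a↑ ∷ b↑ ∷ asc) (there coin∈) (there partner∈) pair reach (there q∈) q≢ sup
    with poke-steps _ ss one! asc coin∈ partner∈ pair reach q∈ q≢ sup
  ... | ts , one!′ , asc′ , arr , r = two a b ∷ ts , one!′ , a↑ ∷ b↑ ∷ asc′ , arr , there r
  poke-steps p (two a b ∷ ss) one! (a↑ ∷ b↑ ∷ asc) {partner = partner} (there coin∈) (there partner∈)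
             pair reach (here refl) q≢ sup
    with adjacent⇒move (adjacent-sym sup)
  ... | a′ , refl with adjacent⇒move (adjacent-sym reach) | path-above _ ss asc coin∈
  ... | b′ , coin≡ | n , coin↑
    -- Two moves lead from `p` through the target to the coin, which lies at or beyond the end of
    -- the first step and so at least two higher. Hence `n` is 0, both moves ascend, and the coin is
    -- the end of that step.
    with two-moves {a′} {b′} (subst (_above p by suc (suc n)) coin≡ (above-move a a↑ (above-move b b↑ coin↑)))
  ... | a′↑ , b′↑ , refl with level⇒start _ ss asc coin∈ coin↑
  ... | refl = divide ss one! asc partner∈
    where
    divide : ∀ ss → singles ss ≡ 1 → Ascending (word ss) → partner ∈ˡ path advance (move b (move a p)) ss →
             ∃ λ ts → singles ts ≡ 1 × Ascending (word ts) ×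
               arrive advance p ts ≡ arrive advance (move b (move a p)) ss ×
               Replace (move b (move a p)) (move a′ p)
                 (p ∷ path advance (move b (move a p)) ss) (path advance p ts)
    -- The target splits the step from `p`; the second half joins the single letter `e` to form the
    -- new pair.
    divide (one e ∷ ss) one! (e↑ ∷ asc) _ = one a′ ∷ two b′ e ∷ ss , one! , a′↑ ∷ b′↑ ∷ e↑ ∷ asc , arr , r
      where
      arr = cong (λ r → arrive advance (move e r) ss) (sym coin≡)
      r   = replace-second (cong (λ r → path advance (move e r) ss) coin≡)
    divide (two c d ∷ ss) one! asc (here refl) = ⊥-elim (adjacent⇒≢ pair refl)
    divide (two c d ∷ ss) one! (c↑ ∷ d↑ ∷ asc) (there partner∈) =
      ⊥-elim (above⇒¬adjacent (above-move c c↑ (above-move d d↑ (proj₂ (path-above _ ss asc partner∈)))) pair)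
  poke-steps p (one e ∷ ss) one! asc (here refl) _ _ _ (here refl) q≢ _ = ⊥-elim (q≢ refl)
  -- The supporter, two moves from the coin `p`, has its colour, whereas all coins after the single
  -- step have the other one.
  poke-steps p (one e ∷ ss) one! asc (here refl) _ _ reach (there q∈) q≢ sup =
    ⊥-elim (p≢p⁻¹ (trans (sym (colour-two-apart reach sup))
      (trans (colour-constant _ ss (ℕ.suc-injective one!) q∈) (colour-move e p))))
  poke-steps p (one e ∷ ss) one! asc (there coin∈) (there partner∈) pair _ _ _ _ =
    ⊥-elim (no-adjacent _ ss (ℕ.suc-injective one!) coin∈ partner∈ pair)
  poke-steps p (one e ∷ ss) one! (e↑ ∷ asc) {target = target} {q} (there coin∈) (here refl) pair reach q∈ q≢ sup
    with path-above _ ss asc coin∈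
  ... | suc n , coin↑ = ⊥-elim (above⇒¬adjacent (above-move e e↑ coin↑) (adjacent-sym pair))
  ... | zero , coin↑ with level⇒start _ ss asc coin∈ coin↑
  ... | refl = divide ss (ℕ.suc-injective one!) asc q∈
    where
    divide : ∀ ss → singles ss ≡ 0 → Ascending (word ss) → q ∈ˡ p ∷ path advance (move e p) ss →
             ∃ λ ts → singles ts ≡ 1 × Ascending (word ts) ×
               arrive advance p ts ≡ arrive advance (move e p) ss ×
               Replace (move e p) target (p ∷ path advance (move e p) ss) (path advance p ts)
    divide ss _ _ (here refl) = ⊥-elim (p≢p⁻¹ (trans (colour-two-apart reach sup) (colour-move e p)))
    divide [] _ _ (there (here refl)) = ⊥-elim (q≢ refl)
    divide (two a b ∷ ss) none asc (there (here refl)) = ⊥-elim (q≢ refl)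
    divide (two a b ∷ ss) none (a↑ ∷ b↑ ∷ asc) (there (there q∈))
      with adjacent⇒move reach
    ... | a′ , refl with adjacent⇒move sup | path-above _ ss asc q∈
    ... | b′ , q≡ | n , q↑
      with two-moves {a′} {b′} (subst (_above move e p by suc (suc n)) q≡
                                (above-move a a↑ (above-move b b↑ q↑)))
    ... | a′↑ , b′↑ , refl with level⇒start _ ss asc q∈ q↑
    ... | refl = two e a′ ∷ one b′ ∷ ss , cong suc none , e↑ ∷ a′↑ ∷ b′↑ ∷ asc , arr , r
      where
      arr = cong (λ r → arrive advance r ss) (sym q≡)
      r   = replace-second (cong (λ r → path advance r ss) q≡)

  record Hop (ps qs : List Position) : Set where
    field
      {coin partner target supporter} : Position
      partner∈         : partner ∈ˡ ps
      supporter∈       : supporter ∈ˡ ps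
      pair             : Adjacent coin partner
      reachable        : Adjacent coin target
      supporter≢coin   : supporter ≢ coin
      target~supporter : Adjacent target supporter
      replace          : Replace coin target ps qs

  Hop-∷ : ∀ {p ps qs} → Hop ps qs → Hop (p ∷ ps) (p ∷ qs)
  Hop-∷ hop = record
    { partner∈ = there partner∈ ; supporter∈ = there supporter∈ ; pair = pair ; reachable = reachable
    ; supporter≢coin = supporter≢coin ; target~supporter = target~supporter ; replace = there replace }
    where open Hop hop

  -- In `forth`, the coin after the first move leaves its partner `p` for the position next to the
  -- coin beyond; `back` reverses this. A `flip` keeps the list of coins because moves commute.
  hop : ∀ p {ss ts} → ss ⇝ ts → Ascending (word ss) →
        Hop (path advance p ss) (path advance p ts) ⊎ path advance p ss ≡ path advance p ts
  hop p (forth {a} {b} {c} {ss}) (a↑ ∷ b↑ ∷ c↑ ∷ asc) = inj₁ record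
    { partner∈         = here refl
    ; supporter∈       = there (there (start∈path advance _ ss))
    ; pair             = adjacent-sym (adjacent-move a p)
    ; reachable        = adjacent-move b _
    ; supporter≢coin   = above⇒≢ (above-move b b↑ (above-move c c↑ (self-above _))) ∘ sym
    ; target~supporter = adjacent-move c _
    ; replace          = there here }
  hop p (back {a} {b} {c} {ss}) (a↑ ∷ b↑ ∷ c↑ ∷ asc) = inj₁ record
    { partner∈         = there (there (start∈path advance _ ss))
    ; supporter∈       = here refl
    ; pair             = adjacent-move c _
    ; reachable        = adjacent-sym (adjacent-move b _)
    ; supporter≢coin   = above⇒≢ (above-move a a↑ (above-move b b↑ (self-above _)))
    ; target~supporter = adjacent-sym (adjacent-move a p)
    ; replace          = there here }
  hop p (flip {a} {b} {ss}) asc = inj₂ (cong (λ q → p ∷ path advance q ss) (move-comm b a p))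
  hop p (there {one a} m)   (_ ∷ asc)     = [ inj₁ ∘ Hop-∷ , inj₂ ∘ cong (p ∷_) ]′ (hop _ m asc)
  hop p (there {two a b} m) (_ ∷ _ ∷ asc) = [ inj₁ ∘ Hop-∷ , inj₂ ∘ cong (p ∷_) ]′ (hop _ m asc)

-- Staircases as competitors

stairs : ℕ → ℕ → List Direction
stairs zero    zero    = []
stairs zero    (suc n) = up ∷ stairs zero n
stairs (suc m) n       = right ∷ stairs m n

below-xs-stairs : ∀ m n → below (xs (stairs m n)) ≡ 0
below-xs-stairs zero    zero    = refl
below-xs-stairs zero    (suc n) = below-xs-stairs zero n
below-xs-stairs (suc m) n       = cong (_∸ 1) (below-xs-stairs m n)

above-xs-stairs : ∀ m n → above (xs (stairs m n)) ≡ m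
above-xs-stairs zero    zero    = refl
above-xs-stairs zero    (suc n) = above-xs-stairs zero n
above-xs-stairs (suc m) n       = cong suc (above-xs-stairs m n)

below-ys-stairs : ∀ m n → below (ys (stairs m n)) ≡ 0
below-ys-stairs zero    zero    = refl
below-ys-stairs zero    (suc n) = cong (_∸ 1) (below-ys-stairs zero n)
below-ys-stairs (suc m) n       = below-ys-stairs m n

above-ys-stairs : ∀ m n → above (ys (stairs m n)) ≡ n
above-ys-stairs zero    zero    = refl
above-ys-stairs zero    (suc n) = cong suc (above-ys-stairs zero n)
above-ys-stairs (suc m) n       = above-ys-stairs m n

length-stairs : ∀ m n → length (stairs m n) ≡ m + n
length-stairs zero    zero    = refl
length-stairs zero    (suc n) = cong suc (length-stairs zero n)
length-stairs (suc m) n       = cong suc (length-stairs m n)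

module NorthEast = Quadrant 1ℤ 1ℤ (inj₁ refl) (inj₁ refl)

stairs-ascending : ∀ m n → NorthEast.Ascending (stairs m n)
stairs-ascending zero    zero    = []
stairs-ascending zero    (suc n) = refl ∷ stairs-ascending zero n
stairs-ascending (suc m) n       = refl ∷ stairs-ascending m n

word-group : ∀ w → word (group w) ≡ w
word-group []          = refl
word-group (d ∷ [])    = refl
word-group (d ∷ e ∷ w) = cong (λ v → d ∷ e ∷ v) (word-group w)

length-group : ∀ w → length (group w) ≡ ⌈ length w /2⌉
length-group []          = refl
length-group (d ∷ [])    = refl
length-group (d ∷ e ∷ w) = cong suc (length-group w)

-- The same interval described from its lower end, where a staircase starts.
rebase : ∀ i a b → Between (ℤ.- + a ℤ.+ i) 0 (a + b) ≐ Between i a b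
rebase i a b = to , from
  where
  upper : ∀ a b i → (a ℤ.+ b) ℤ.+ (ℤ.- a ℤ.+ i) ≡ b ℤ.+ i
  upper = solve-∀
  lower⁺ : ∀ a i → a ℤ.+ (ℤ.- a ℤ.+ i) ≡ i
  lower⁺ = solve-∀
  lower⁻ : ∀ a i → ℤ.- a ℤ.+ (a ℤ.+ i) ≡ i
  lower⁻ = solve-∀
  to : Between (ℤ.- + a ℤ.+ i) 0 (a + b) ⊆ Between i a b
  to {z} (lo , hi) =
    subst (ℤ._≤ + a ℤ.+ z) (lower⁺ (+ a) i)
      (ℤ.+-monoʳ-≤ (+ a) (ℤ.≤-trans lo (ℤ.≤-reflexive (ℤ.+-identityˡ z)))) ,
    subst (z ℤ.≤_) (upper (+ a) (+ b) i) hi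
  from : Between i a b ⊆ Between (ℤ.- + a ℤ.+ i) 0 (a + b)
  from {z} (lo , hi) =
    subst (ℤ.- + a ℤ.+ i ℤ.≤_) (trans (lower⁻ (+ a) z) (sym (ℤ.+-identityˡ z)))
      (ℤ.+-monoʳ-≤ (ℤ.- + a) lo) ,
    subst (z ℤ.≤_) (sym (upper (+ a) (+ b) i)) hi

-- The competitor with which minimality compares a chain: same hull, but a
-- monotone walk cut into pairs.
hullCorner : Position → List Direction → Position
hullCorner (x , y) w = ℤ.- + below (xs w) ℤ.+ x , ℤ.- + below (ys w) ℤ.+ y

hullStairs : List Direction → List Direction
hullStairs w = stairs (width (xs w)) (width (ys w))

Hull-stairs : ∀ p w → Hull (hullCorner p w) (hullStairs w) ≐ Hull p w
Hull-stairs p w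
  rewrite below-xs-stairs (width (xs w)) (width (ys w)) | above-xs-stairs (width (xs w)) (width (ys w))
        | below-ys-stairs (width (xs w)) (width (ys w)) | above-ys-stairs (width (xs w)) (width (ys w)) =
  (λ (x , y) → proj₁ (rebase _ (below (xs w)) (above (xs w))) x ,
               proj₁ (rebase _ (below (ys w)) (above (ys w))) y) ,
  (λ (x , y) → proj₂ (rebase _ (below (xs w)) (above (xs w))) x ,
               proj₂ (rebase _ (below (ys w)) (above (ys w))) y)

stairs-unique : ∀ p m n → Unique (path advance p (group (stairs m n)))
stairs-unique p m n = NorthEast.ascending⇒unique p (group (stairs m n))
  (subst NorthEast.Ascending (sym (word-group (stairs m n))) (stairs-ascending m n))

staircase : Position → List Direction → Configuration
staircase p w = configuration (path advance (hullCorner p w) (group (hullStairs w)))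
                              (stairs-unique _ (width (xs w)) (width (ys w)))

span-staircase : ∀ p w → span (staircase p w) ≐ Hull p w
span-staircase p w = ≐-trans
  (subst (λ v → span (staircase p w) ≐ Hull (hullCorner p w) v) (word-group (hullStairs w))
    (span-chain (staircase p w) _ (group (hullStairs w)) (unique (staircase p w)) ≐-refl))
  (Hull-stairs p w)

size-staircase : ∀ p w → size (staircase p w) ≡ suc ⌈ width (xs w) + width (ys w) /2⌉
size-staircase p w = begin
  size (staircase p w)                      ≡⟨ length-path advance _ (group (hullStairs w)) ⟩
  suc (length (group (hullStairs w)))       ≡⟨ cong suc (length-group (hullStairs w)) ⟩
  suc ⌈ length (hullStairs w) /2⌉           ≡⟨ cong (λ n → suc ⌈ n /2⌉)
                                                 (length-stairs (width (xs w)) (width (ys w))) ⟩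
  suc ⌈ width (xs w) + width (ys w) /2⌉     ∎
  where open ≡-Reasoning

-- Counting letters against the competitor

⌈n/2⌉+⌈n/2⌉≤1+n : ∀ n → ⌈ n /2⌉ + ⌈ n /2⌉ ≤ suc n
⌈n/2⌉+⌈n/2⌉≤1+n zero          = z≤n
⌈n/2⌉+⌈n/2⌉≤1+n (suc zero)    = ℕ.≤-refl
⌈n/2⌉+⌈n/2⌉≤1+n (suc (suc n)) =
  s≤s (ℕ.≤-trans (ℕ.≤-reflexive (ℕ.+-suc ⌈ n /2⌉ ⌈ n /2⌉)) (s≤s (⌈n/2⌉+⌈n/2⌉≤1+n n)))

-- Each step counts twice: a `two` by its letters, a `one` by its letter and again as a single step.
length-word+singles : ∀ ss → length (word ss) + singles ss ≡ length ss + length ss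
length-word+singles []             = refl
length-word+singles (one d ∷ ss)   = cong suc (begin
  length (word ss) + suc (singles ss)   ≡⟨ ℕ.+-suc (length (word ss)) (singles ss) ⟩
  suc (length (word ss) + singles ss)   ≡⟨ cong suc (length-word+singles ss) ⟩
  suc (length ss + length ss)           ≡⟨ ℕ.+-suc (length ss) (length ss) ⟨
  length ss + suc (length ss)           ∎)
  where open ≡-Reasoning
length-word+singles (two d e ∷ ss) = cong suc (trans (cong suc (length-word+singles ss))
  (sym (ℕ.+-suc (length ss) (length ss))))

module _ (C : Configuration) (min : Minimum C) (p : Position) (ss : List Step)
         (ss! : Unique (path advance p ss)) (covers : ⟦ C ⟧ ≐ (_∈ˡ path advance p ss)) where

  private
    w = word ss
    W = width (xs w) + width (ys w)

  minimum⇒short : length ss ≤ ⌈ W /2⌉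
  minimum⇒short = ℕ.s≤s⁻¹ (begin
    suc (length ss)            ≡⟨ length-path advance p ss ⟨
    length (path advance p ss) ≤⟨ unique⇒length≤ ss! (proj₂ covers) ⟩
    size C                     ≤⟨ ℕ.≮⇒≥ (min (staircase p w) (≐-trans (span-staircase p w)
                                    (≐-sym (span-chain C p ss ss! covers)))) ⟩
    size (staircase p w)       ≡⟨ size-staircase p w ⟩
    suc ⌈ W /2⌉                ∎)
    where open ℕ.≤-Reasoning

  -- The extra unit is what doubling `⌈ W /2⌉` can add to `W`.
  length+singles≤ : length w + singles ss ≤ suc W
  length+singles≤ = begin
    length w + singles ss   ≡⟨ length-word+singles ss ⟩
    length ss + length ss   ≤⟨ ℕ.+-mono-≤ minimum⇒short minimum⇒short ⟩
    ⌈ W /2⌉ + ⌈ W /2⌉       ≤⟨ ⌈n/2⌉+⌈n/2⌉≤1+n W ⟩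
    suc W                   ∎
    where open ℕ.≤-Reasoning

  W≤length : W ≤ length w
  W≤length = ℕ.≤-trans (ℕ.+-mono-≤ (width≤pluses+minuses (xs w)) (width≤pluses+minuses (ys w)))
                       (ℕ.≤-reflexive (sym (length-word w)))

  minimum⇒single : singles ss ≢ 0 → singles ss ≡ 1
  minimum⇒single ss≢0 = ℕ.≤-antisym
    (ℕ.+-cancelˡ-≤ (length w) _ _ (begin
      length w + singles ss ≤⟨ length+singles≤ ⟩
      suc W                 ≤⟨ s≤s W≤length ⟩
      suc (length w)        ≡⟨ ℕ.+-comm 1 (length w) ⟩
      length w + 1          ∎))
    (ℕ.n≢0⇒n>0 ss≢0)
    where open ℕ.≤-Reasoning

  module _ (ss≢0 : singles ss ≢ 0) where

    -- The single step has already consumed the extra unit.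
    length≤W : length w ≤ W
    length≤W = ℕ.s≤s⁻¹ (begin
      suc (length w)        ≡⟨ ℕ.+-comm 1 (length w) ⟩
      length w + 1          ≡⟨ cong (λ n → length w + n) (minimum⇒single ss≢0) ⟨
      length w + singles ss ≤⟨ length+singles≤ ⟩
      suc W                 ∎)
      where open ℕ.≤-Reasoning

    private
      tx = xs w
      ty = ys w
      moves≤W : (pluses tx + minuses tx) + (pluses ty + minuses ty) ≤ width tx + width ty
      moves≤W = ℕ.≤-trans (ℕ.≤-reflexive (sym (length-word w))) length≤W

    -- The bound on the total splits by axis: the width on the other axis is at most its number of
    -- moves, which can be cancelled.
    minimum⇒oneWay-x : OneWay (xs w)
    minimum⇒oneWay-x = widest⇒oneWay tx (ℕ.+-cancelʳ-≤ (pluses ty + minuses ty) _ _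
      (ℕ.≤-trans moves≤W (ℕ.+-monoʳ-≤ (width tx) (width≤pluses+minuses ty))))

    minimum⇒oneWay-y : OneWay (ys w)
    minimum⇒oneWay-y = widest⇒oneWay ty (ℕ.+-cancelˡ-≤ (pluses tx + minuses tx) _ _
      (ℕ.≤-trans moves≤W (ℕ.+-monoˡ-≤ (width ty) (width≤pluses+minuses tx))))

-- The shape of a minimum chain with a single step

record TightChain (c c′ : Position) (C : Configuration) : Set where
  field
    moves    : List Step
    single   : singles moves ≡ 1
    oneWay-x : OneWay (xs (word moves))
    oneWay-y : OneWay (ys (word moves))
    arrives  : arrive advance c moves ≡ c′
    covers   : ⟦ C ⟧ ≐ (_∈ˡ path advance c moves)

walk₁ : ∀ {p q} → Walk 1 p q → ∃ λ d → q ≡ move d p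
walk₁ (step adj stop) = adjacent⇒move adj

walk₂ : ∀ {p q} → Walk 2 p q → ∃₂ λ d e → q ≡ move e (move d p)
walk₂ (step adj walk) with adjacent⇒move adj | walk₁ walk
... | d , refl | e , eq = d , e , eq

linked⇒steps : ∀ {p ps} → Linked (λ p q → Dist p q 1 ⊎ Dist p q 2) (p ∷ ps) →
               ∃ λ ss → p ∷ ps ≡ path advance p ss
linked⇒steps [-] = [] , refl
linked⇒steps {p} (dist ∷ linked) with linked⇒steps linked
linked⇒steps {p} (inj₁ (walk , _) ∷ linked) | ss , eq with walk₁ walk
... | d , refl = one d ∷ ss , cong (p ∷_) eq
linked⇒steps {p} (inj₂ (walk , _) ∷ linked) | ss , eq with walk₂ walk
... | d , e , refl = two d e ∷ ss , cong (p ∷_) eq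

chain⇒steps : ∀ {c c′ C} → Chain c c′ C → ∃ λ ss →
              Unique (path advance c ss) × arrive advance c ss ≡ c′ × ⟦ C ⟧ ≐ (_∈ˡ path advance c ss)
chain⇒steps {c} {c′} {C} chain = go sequence distinct first final steps covers
  where
  open Chain chain
  go : ∀ ps → Unique ps → head ps ≡ just c → last ps ≡ just c′ →
       Linked (λ p q → Dist p q 1 ⊎ Dist p q 2) ps → ⟦ C ⟧ ≐ (_∈ˡ ps) → ∃ λ ss →
       Unique (path advance c ss) × arrive advance c ss ≡ c′ × ⟦ C ⟧ ≐ (_∈ˡ path advance c ss)
  go (p ∷ ps) ps! refl ps-last linked C≐ with linked⇒steps linked
  ... | ss , eq rewrite eq = ss , ps! , just-injective (trans (sym (last-path advance c ss)) ps-last) , C≐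

-- Minimality by itself does not produce a single step, so its absence has to be excluded
-- separately: by the adjacent pair for `M`, by the colours of the ends for `M′`.
tight : ∀ {c c′ C} → MinimumChain c c′ C →
        (∀ ss → singles ss ≡ 0 → arrive advance c ss ≡ c′ → ¬ ⟦ C ⟧ ≐ (_∈ˡ path advance c ss)) →
        TightChain c c′ C
tight {c} {c′} {C} (chain , min) not-all-two with chain⇒steps chain
... | ss , ss! , arr , covers = record
  { moves    = ss
  ; single   = minimum⇒single C min c ss ss! covers some-one
  ; oneWay-x = minimum⇒oneWay-x C min c ss ss! covers some-one
  ; oneWay-y = minimum⇒oneWay-y C min c ss ss! covers some-one
  ; arrives  = arr
  ; covers   = covers }
  where
  some-one : singles ss ≢ 0
  some-one ss≡0 = not-all-two ss ss≡0 arr covers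

adjacentPair⇒tight : ∀ {c c′ C} → MinimumChain c c′ C → HasAdjacentPair C → TightChain c c′ C
adjacentPair⇒tight mc (p , q , p∈ , q∈ , adj) = tight mc λ ss ss≡0 _ (C⊆ , _) →
  no-adjacent _ ss ss≡0 (C⊆ p∈) (C⊆ q∈) adj

colour-single : ∀ p ss → singles ss ≡ 1 → colour (arrive advance p ss) ≡ colour p ⁻¹
colour-single p (one d ∷ ss)   one! = trans
  (colour-constant _ ss (ℕ.suc-injective one!) (arrive∈path advance _ ss)) (colour-move d p)
colour-single p (two d e ∷ ss) one! = trans (colour-single _ ss one!)
  (cong _⁻¹ (colour-two-apart (adjacent-move d p) (adjacent-move e _)))

-- The colours of the end coins force a step of length one.
sameEnds⇒tight : ∀ {c c′ C D} → TightChain c c′ C → MinimumChain c c′ D → TightChain c c′ D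
sameEnds⇒tight {c} {c′} T mc = tight mc λ ss ss≡0 arr _ → p≢p⁻¹ (begin
  colour c                          ≡⟨ colour-constant c ss ss≡0 (arrive∈path advance c ss) ⟨
  colour (arrive advance c ss)      ≡⟨ cong colour (trans arr (sym arrives)) ⟩
  colour (arrive advance c moves)   ≡⟨ colour-single c moves single ⟩
  colour c ⁻¹                       ∎)
  where
  open TightChain T
  open ≡-Reasoning

-- Monotone words are determined up to order by their ends

sort : ∀ w → w ↭ replicate (pluses (xs w)) right ++ replicate (minuses (xs w)) left ++
                 replicate (pluses (ys w)) up ++ replicate (minuses (ys w)) down
sort []          = ↭-refl
sort (right ∷ w) = ↭-prep right (sort w)
sort (left ∷ w)  = ↭-trans (↭-prep left (sort w))
  (↭-sym (↭-shift left (replicate (pluses (xs w)) right) _))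
sort (up ∷ w)    = ↭-trans (↭-prep up (sort w)) (↭-sym (↭-trans
  (++⁺ˡ (replicate (pluses (xs w)) right) (↭-shift up (replicate (minuses (xs w)) left) _))
  (↭-shift up (replicate (pluses (xs w)) right) _)))
sort (down ∷ w)  = ↭-trans (↭-prep down (sort w)) (↭-sym (↭-trans
  (++⁺ˡ (replicate (pluses (xs w)) right) (↭-trans
    (++⁺ˡ (replicate (minuses (xs w)) left) (↭-shift down (replicate (pluses (ys w)) up) _))
    (↭-shift down (replicate (minuses (xs w)) left) _)))
  (↭-shift down (replicate (pluses (xs w)) right) _)))

-- With one of them zero, p and m are the positive and negative parts of p - m, and the equation
-- says that both differences agree.
cancel-zeros : ∀ {p m p′ m′} → m ≡ 0 ⊎ p ≡ 0 → m′ ≡ 0 ⊎ p′ ≡ 0 → p + m′ ≡ p′ + m → p ≡ p′ × m ≡ m′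
cancel-zeros {p} {p′ = p′} (inj₁ refl) (inj₁ refl) eq = ℕ.+-cancelʳ-≡ 0 p p′ eq , refl
cancel-zeros {p} {m′ = m′} (inj₁ refl) (inj₂ refl) eq =
  ℕ.m+n≡0⇒m≡0 p eq , sym (ℕ.m+n≡0⇒n≡0 p eq)
cancel-zeros {m = m} {p′} (inj₂ refl) (inj₁ refl) eq =
  sym (ℕ.m+n≡0⇒m≡0 p′ (sym eq)) , ℕ.m+n≡0⇒n≡0 p′ (sym eq)
cancel-zeros (inj₂ refl) (inj₂ refl) eq = refl , sym eq

oneWay-determined : ∀ i ts us → OneWay ts → OneWay us → arrive shift i ts ≡ arrive shift i us →
                    pluses ts ≡ pluses us × minuses ts ≡ minuses us
oneWay-determined i ts us ts→ us→ same = cancel-zeros ts→ us→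
  (ℤ.+-injective (+-cancelʳ (i ℤ.+ e) _ _ (begin
    (P ts ℤ.+ M us) ℤ.+ (i ℤ.+ e)   ≡⟨ regroup (P ts) (M us) i e ⟩
    (P ts ℤ.+ i) ℤ.+ (M us ℤ.+ e)   ≡⟨ cong₂ ℤ._+_ (sym (displacement i ts)) us-displacement ⟩
    (M ts ℤ.+ e) ℤ.+ (P us ℤ.+ i)   ≡⟨ regroup′ (M ts) (P us) i e ⟩
    (P us ℤ.+ M ts) ℤ.+ (i ℤ.+ e)   ∎)))
  where
  open ≡-Reasoning
  e = arrive shift i ts
  P M : List Shift → ℤ
  P ts = + pluses ts
  M ts = + minuses ts
  us-displacement : M us ℤ.+ e ≡ P us ℤ.+ i
  us-displacement = trans (cong (λ j → M us ℤ.+ j) same) (displacement i us)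
  regroup : ∀ a b i e → (a ℤ.+ b) ℤ.+ (i ℤ.+ e) ≡ (a ℤ.+ i) ℤ.+ (b ℤ.+ e)
  regroup = solve-∀
  regroup′ : ∀ a b i e → (a ℤ.+ e) ℤ.+ (b ℤ.+ i) ≡ (b ℤ.+ a) ℤ.+ (i ℤ.+ e)
  regroup′ = solve-∀

oneWay⇒↭ : ∀ p w v → OneWay (xs w) → OneWay (ys w) → OneWay (xs v) → OneWay (ys v) →
           arrive move p w ≡ arrive move p v → w ↭ v
oneWay⇒↭ p w v wx wy vx vy same = ↭-trans (sort w) (↭-trans (↭-reflexive blocks) (↭-sym (sort v)))
  where
  x-counts : pluses (xs w) ≡ pluses (xs v) × minuses (xs w) ≡ minuses (xs v)
  x-counts = oneWay-determined (proj₁ p) (xs w) (xs v) wx vx (trans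
    (sym (map-arrive proj₁ horizontally proj₁-move p w))
    (trans (cong proj₁ same) (map-arrive proj₁ horizontally proj₁-move p v)))
  y-counts : pluses (ys w) ≡ pluses (ys v) × minuses (ys w) ≡ minuses (ys v)
  y-counts = oneWay-determined (proj₂ p) (ys w) (ys v) wy vy (trans
    (sym (map-arrive proj₂ vertically proj₂-move p w))
    (trans (cong proj₂ same) (map-arrive proj₂ vertically proj₂-move p v)))
  blocks = cong₂ _++_ (cong (λ n → replicate n right) (proj₁ x-counts))
          (cong₂ _++_ (cong (λ n → replicate n left) (proj₂ x-counts))
          (cong₂ _++_ (cong (λ n → replicate n up) (proj₁ y-counts))
                      (cong (λ n → replicate n down) (proj₂ y-counts))))

-- Climbing chains and pokes

Oriented : ℤ → List Shift → Set
Oriented s ts = s ≡ 1ℤ × minuses ts ≡ 0 ⊎ s ≡ -1ℤ × pluses ts ≡ 0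

-- One sign for each axis selects the quadrant in which the height increases along the walk.
oneWay⇒oriented : ∀ ts → OneWay ts → ∃ λ s → IsUnit s × Oriented s ts
oneWay⇒oriented ts (inj₁ none) = 1ℤ , inj₁ refl , inj₁ (refl , none)
oneWay⇒oriented ts (inj₂ none) = -1ℤ , inj₂ refl , inj₂ (refl , none)

oriented-plus : ∀ {s} ts → Oriented s (plus ∷ ts) → s ≡ 1ℤ × Oriented s ts
oriented-plus ts (inj₁ (s≡1 , none)) = s≡1 , inj₁ (s≡1 , none)

oriented-minus : ∀ {s} ts → Oriented s (minus ∷ ts) → ℤ.- s ≡ 1ℤ × Oriented s ts
oriented-minus ts (inj₂ (s≡-1 , none)) = cong ℤ.-_ s≡-1 , inj₂ (s≡-1 , none)

module Climb (s t : ℤ) (unit-s : IsUnit s) (unit-t : IsUnit t) where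

  open Quadrant s t unit-s unit-t

  oriented⇒ascending : ∀ w → Oriented s (xs w) → Oriented t (ys w) → Ascending w
  oriented⇒ascending []          ox oy = []
  oriented⇒ascending (left ∷ w)  ox oy =
    let s↑ , ox′ = oriented-minus (xs w) ox in s↑ ∷ oriented⇒ascending w ox′ oy
  oriented⇒ascending (right ∷ w) ox oy =
    let s↑ , ox′ = oriented-plus (xs w) ox in s↑ ∷ oriented⇒ascending w ox′ oy
  oriented⇒ascending (up ∷ w)    ox oy =
    let t↑ , oy′ = oriented-plus (ys w) oy in t↑ ∷ oriented⇒ascending w ox oy′
  oriented⇒ascending (down ∷ w)  ox oy =
    let t↑ , oy′ = oriented-minus (ys w) oy in t↑ ∷ oriented⇒ascending w ox oy′

  -- This is the invariant carried through pokes. Ascent gives back distinctness and exact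
  -- distances, so that a `Chain` can be rebuilt at the end.
  record ClimbingChain (c c′ : Position) (C : Configuration) : Set where
    field
      moves     : List Step
      single    : singles moves ≡ 1
      ascending : Ascending (word moves)
      arrives   : arrive advance c moves ≡ c′
      covers    : ⟦ C ⟧ ≐ (_∈ˡ path advance c moves)

  climbing⇒chain : ∀ {c c′ C} → ClimbingChain c c′ C → Chain c c′ C
  climbing⇒chain {c} climb = record
    { sequence = path advance c moves
    ; distinct = ascending⇒unique c moves ascending
    ; first    = head-path advance c moves
    ; final    = trans (last-path advance c moves) (cong just arrives)
    ; steps    = ascending⇒linked c moves ascending
    ; covers   = covers }
    where open ClimbingChain climb

  climbing-cong : ∀ {c c′ C D} → ⟦ C ⟧ ≐ ⟦ D ⟧ → ClimbingChain c c′ C → ClimbingChain c c′ D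
  climbing-cong C≐D climb = record
    { moves = moves ; single = single ; ascending = ascending ; arrives = arrives
    ; covers = ≐-trans (≐-sym C≐D) covers }
    where open ClimbingChain climb

  replacement-cong : ∀ {P Q : Pred Position 0ℓ} {p q} → P ≐ Q →
                     ((P ∖ ｛ p ｝) ∪ ｛ q ｝) ≐ ((Q ∖ ｛ p ｝) ∪ ｛ q ｝)
  replacement-cong (P⊆Q , Q⊆P) =
    (λ { (inj₁ (x∈ , p≢x)) → inj₁ (P⊆Q x∈ , p≢x) ; (inj₂ q≡x) → inj₂ q≡x }) ,
    (λ { (inj₁ (x∈ , p≢x)) → inj₁ (Q⊆P x∈ , p≢x) ; (inj₂ q≡x) → inj₂ q≡x })

  poke-climbing : ∀ {R c c′ M N} → Poke R M N → ClimbingChain c c′ M → ClimbingChain c c′ N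
  poke-climbing {c = c} poke climb
    with poke-steps c (ClimbingChain.moves climb) (ClimbingChain.single climb) (ClimbingChain.ascending climb)
           (proj₁ (ClimbingChain.covers climb) (Poke.coin∈M poke))
           (proj₁ (ClimbingChain.covers climb) (Poke.partner∈M poke))
           (Poke.pair poke) (Poke.reachable poke)
           (proj₁ (ClimbingChain.covers climb) (proj₁ (proj₂ (Poke.supported poke))))
           (proj₁ (proj₂ (proj₂ (Poke.supported poke))))
           (proj₂ (proj₂ (proj₂ (Poke.supported poke))))
  ... | ts , one! , asc , arr , r = record
    { moves     = ts
    ; single    = one!
    ; ascending = asc
    ; arrives   = trans arr arrives
    ; covers    = ≐-trans (Poke.result poke) (≐-trans (replacement-cong covers) (≐-sym
        (replace-≐ _≟ᴾ_ r (ascending⇒unique c moves ascending) (ascending⇒unique c ts asc)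
          (adjacent⇒≢ (Poke.reachable poke))))) }
    where open ClimbingChain climb

  pokes-climbing : ∀ {R c c′ M N} → Star (Poke R) M N → Minimum M → ClimbingChain c c′ M →
                   ClimbingChain c c′ N × Minimum N
  pokes-climbing ε              min climb = climb , min
  pokes-climbing (poke ◅ pokes) min climb = pokes-climbing pokes (poke-minimum poke) (poke-climbing poke climb)

  hop⇒poke : ∀ {R M N ps qs} → Minimum M → HasSpan M R → ⟦ M ⟧ ≐ (_∈ˡ ps) → ⟦ N ⟧ ≐ (_∈ˡ qs) →
             Unique ps → Unique qs → Hop ps qs → Poke R M N
  hop⇒poke min spans (M⊆ , M⊇) N≐ ps! qs! hop = record
    { minimum   = min
    ; spans     = spans
    ; coin∈M    = M⊇ (old∈ replace)
    ; partner∈M = M⊇ partner∈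
    ; pair      = pair
    ; reachable = reachable
    ; free      = new∉ replace qs! (adjacent⇒≢ reachable) ∘ M⊆
    ; supported = _ , M⊇ supporter∈ , supporter≢coin , target~supporter
    ; result    = ≐-trans N≐ (≐-trans (replace-≐ _≟ᴾ_ replace ps! qs! (adjacent⇒≢ reachable))
                    (replacement-cong (M⊇ , M⊆))) }
    where open Hop hop

  -- Regrouping and flipping only permute letters, so ascent persists and each intermediate list of
  -- coins is free of repetition, hence a configuration. Where the list of coins does not change,
  -- `M` is kept and no poke is added.
  moves⇒pokes : ∀ {R M N} p {ss ts} → Star _⇝_ ss ts → Ascending (word ss) → Minimum M → HasSpan M R →
                ⟦ M ⟧ ≐ (_∈ˡ path advance p ss) → ⟦ N ⟧ ≐ (_∈ˡ path advance p ts) → M ⟶𝒫[ R ] N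
  moves⇒pokes p ε asc min spans M≐ N≐ = _ , ε , ≐-trans M≐ (≐-sym N≐)
  moves⇒pokes {M = M} {N} p (_◅_ {j = ss′} m ms) asc min spans M≐ N≐ with hop p m asc
  ... | inj₂ eq = moves⇒pokes {N = N} p ms (All-resp-↭ (⇝⇒↭ m) asc) min spans
                    (subst (λ ps → ⟦ M ⟧ ≐ (_∈ˡ ps)) eq M≐) N≐
  ... | inj₁ h  =
    let N′ , pokes , N′≐N = moves⇒pokes {N = N} p ms asc′ (poke-minimum poke) (poke-hasSpan poke) ≐-refl N≐
    in N′ , poke ◅ pokes , N′≐N
    where
    asc′ = All-resp-↭ (⇝⇒↭ m) asc
    poke : Poke _ M (configuration (path advance p ss′) (ascending⇒unique p ss′ asc′))
    poke = hop⇒poke min spans M≐ ≐-refl (ascending⇒unique p _ asc) (ascending⇒unique p ss′ asc′) h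

-- The two directions of the equivalence

tight⇒pokes : ∀ {R c c′ M M′} → TightChain c c′ M → Minimum M → HasSpan M R →
              TightChain c c′ M′ → M ⟶𝒫[ R ] M′
tight⇒pokes {c = c} {M′ = M′} T min spans T′
  with oneWay⇒oriented (xs (word (TightChain.moves T))) (TightChain.oneWay-x T)
     | oneWay⇒oriented (ys (word (TightChain.moves T))) (TightChain.oneWay-y T)
... | s , unit-s , ox | t , unit-t , oy =
  Climb.moves⇒pokes s t unit-s unit-t {N = M′} c (connected single T′.single word↭)
    (Climb.oriented⇒ascending s t unit-s unit-t (word moves) ox oy) min spans covers T′.covers
  where
  open TightChain T
  module T′ = TightChain T′
  word↭ : word moves ↭ word T′.moves
  word↭ = oneWay⇒↭ c (word moves) (word T′.moves) oneWay-x oneWay-y T′.oneWay-x T′.oneWay-y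
    (trans (arrive-word c moves) (trans (trans arrives (sym T′.arrives)) (sym (arrive-word c T′.moves))))

pokes⇒minimumChain : ∀ {R c c′ M M′} → TightChain c c′ M → Minimum M → M ⟶𝒫[ R ] M′ →
                     MinimumChain c c′ M′
pokes⇒minimumChain {M′ = M′} T min (N , pokes , N≐M′)
  with oneWay⇒oriented (xs (word (TightChain.moves T))) (TightChain.oneWay-x T)
     | oneWay⇒oriented (ys (word (TightChain.moves T))) (TightChain.oneWay-y T)
... | s , unit-s , ox | t , unit-t , oy =
  let climb , min′ = pokes-climbing pokes min record
        { moves = moves ; single = single ; arrives = arrives ; covers = covers
        ; ascending = oriented⇒ascending (word moves) ox oy }
  in climbing⇒chain (climbing-cong N≐M′ climb) , minimum-cong N M′ N≐M′ min′
  where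
  open TightChain T
  open Climb s t unit-s unit-t

theorem5p9 : (R : Rectangle) → OddRectangle R →
    (M : Configuration) (c c′ : Position) →
    MinimumChain c c′ M → HasSpan M R → HasAdjacentPair M →
    (M′ : Configuration) →
    (M ⟶𝒫[ R ] M′) ⇔ MinimumChain c c′ M′
theorem5p9 R odd M c c′ mc@(_ , min) spans adjacent M′ =
  mk⇔ (pokes⇒minimumChain T min) (λ mc′ → tight⇒pokes T min spans (sameEnds⇒tight T mc′))
  where
  T : TightChain c c′ M
  T = adjacentPair⇒tight mc adjacent
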